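{- $FLO\leq_c FVS$ and $FVS\not\leq_c FLO$.
   Context: All structures are in a finite relational language and have universe a subset of $\omega$; a class of structures consists of structures in a single language and is closed under isomorphism (among structures with universe a subset of $\omega$). $D(\mathcal{A})$ denotes the atomic diagram (atomic sentences and negations of atomic sentences, with elements of $\omega$ as constants, true in $\mathcal{A}$). A computable transformation from $K$ to $K'$ is a c.e. set $\Phi$ of pairs $(\alpha,\varphi)$, $\alpha$ a finite subset of the atomic diagram of a finite structure in the language of $K$, $\varphi$ an atomic sentence or negated atomic sentence in the language of $K'$, such that for each $\mathcal{A}\in K$, $\{\varphi:\exists\alpha\subseteq D(\mathcal{A}),(\alpha,\varphi)\in\Phi\}=D(\mathcal{B})$ for some $\mathcal{B}\in K'$ (write $\Phi(\mathcal{A})=\mathcal{B}$). A computable embedding is a computable transformation with $\mathcal{A}\cong\mathcal{A}'$ iff $\Phi(\mathcal{A})\cong\Phi(\mathcal{A}')$ for all $\mathcal{A},\mathcal{A}'\in K$; $K\leq_c K'$ means a computable embedding of $K$ into $K'$ exists. $FLO$ is the class of finite linear orders. $FVS$ is the class of finite-dimensional vector spaces over $\mathbb{Q}$, viewed as structures in the language $\{V,F,0_F,1_F,+_F,*_F,0_V,+_V,*_V\}$ (sort predicates for vectors and scalars; the scalars form a copy of the field $\mathbb{Q}$ with its zero, one, addition, multiplication; and the zero vector, vector addition and scalar multiplication), with all constants and operations replaced by their graphs so that the language is finite relational. -}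

module Defs where

open import Data.Nat using (ℕ; zero; suc; _+_; _*_; _∸_; _^_; _<_)
open import Data.Fin as Fin using (Fin; toℕ)
open import Data.Bool using (Bool; true; false; T)
open import Data.Vec as Vec using (Vec; []; _∷_)
open import Data.Vec.Relation.Unary.All as VAll using ()
open import Data.List using (List; []; _∷_)
open import Data.List.Relation.Unary.All as LAll using ()
open import Data.List.Membership.Propositional using (_∈_)
open import Data.Product using (Σ; ∃; ∃-syntax; _×_; _,_; proj₁)
open import Data.Sum using (_⊎_; inj₁; inj₂)
open import Data.Unit using (⊤)
open import Data.Empty using (⊥)
open import Relation.Binary.PropositionalEquality using (_≡_; _≢_)
open import Relation.Nullary using (¬_)
open import Function.Bundles using (_⇔_; _↔_; Inverse)
open import Data.Rational as ℚ using (ℚ; 0ℚ; 1ℚ)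

data PR : ℕ → Set where
  zer  : ∀ {n} → PR n
  succ : PR 1
  proj : ∀ {n} → Fin n → PR n
  comp : ∀ {m n} → PR m → Vec (PR n) m → PR n
  prec : ∀ {n} → PR n → PR (suc (suc n)) → PR (suc n)
  mu   : ∀ {n} → PR (suc n) → PR n

mutual
  data _[_]⇓_ : ∀ {n} → PR n → Vec ℕ n → ℕ → Set where
    ⇓zer  : ∀ {n} {xs : Vec ℕ n} → zer [ xs ]⇓ 0
    ⇓succ : ∀ {x} → succ [ x ∷ [] ]⇓ suc x
    ⇓proj : ∀ {n} {i : Fin n} {xs} → proj i [ xs ]⇓ Vec.lookup xs i
    ⇓comp : ∀ {m n} {f : PR m} {gs : Vec (PR n) m} {xs ys y} →
            gs [ xs ]⇓* ys → f [ ys ]⇓ y → comp f gs [ xs ]⇓ y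
    ⇓prec0 : ∀ {n} {f : PR n} {g} {xs y} →
             f [ xs ]⇓ y → prec f g [ 0 ∷ xs ]⇓ y
    ⇓precS : ∀ {n} {f : PR n} {g} {x xs z y} →
             prec f g [ x ∷ xs ]⇓ z → g [ x ∷ z ∷ xs ]⇓ y →
             prec f g [ suc x ∷ xs ]⇓ y
    ⇓mu   : ∀ {n} {f : PR (suc n)} {xs y} →
            f [ y ∷ xs ]⇓ 0 →
            (∀ k → k < y → ∃[ m ] (f [ k ∷ xs ]⇓ suc m)) →
            mu f [ xs ]⇓ y

  data _[_]⇓*_ : ∀ {m n} → Vec (PR n) m → Vec ℕ n → Vec ℕ m → Set where
    []  : ∀ {n} {xs : Vec ℕ n} → [] [ xs ]⇓* []
    _∷_ : ∀ {m n} {g} {gs : Vec (PR n) m} {xs y ys} →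
          g [ xs ]⇓ y → gs [ xs ]⇓* ys → (g ∷ gs) [ xs ]⇓* (y ∷ ys)

Halts : PR 1 → ℕ → Set
Halts c n = ∃[ y ] (c [ n ∷ [] ]⇓ y)

record Code (A : Set) : Set where
  field ⌜_⌝ : A → ℕ
open Code {{...}} public

-- injective pairing  ⟪a,b⟫ = 2^a (2b+1) - 1  (a bijection ℕ×ℕ → ℕ)
⟪_,_⟫ : ℕ → ℕ → ℕ
⟪ a , b ⟫ = 2 ^ a * suc (2 * b) ∸ 1

IsCE : {A : Set} {{_ : Code A}} → (A → Set) → Set
IsCE P = ∃[ c ] (∀ x → P x ⇔ Halts c ⌜ x ⌝)

record Lang : Set where
  field
    size  : ℕ
    arity : Fin size → ℕ
open Lang public

record Structure (L : Lang) : Set where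
  field
    dom     : ℕ → Bool
    rel     : (i : Fin (size L)) → Vec ℕ (arity L i) → Bool
    rel-dom : ∀ i v → T (rel i v) → VAll.All (λ a → T (dom a)) v
open Structure public

FiniteStr : ∀ {L} → Structure L → Set
FiniteStr A = ∃[ xs ] (∀ n → T (dom A n) ⇔ (n ∈ xs))

-- atomic sentences (with equality) and literals, constants from ω
data Atom (L : Lang) : Set where
  eq  : ℕ → ℕ → Atom L
  R[_]_ : (i : Fin (size L)) → Vec ℕ (arity L i) → Atom L

-- (true , a) is the atomic sentence a, (false , a) its negation
Literal : Lang → Set
Literal L = Bool × Atom L

D : ∀ {L} → Structure L → Literal L → Set
D A (true  , eq a b)  = T (dom A a) × a ≡ b
D A (false , eq a b)  = T (dom A a) × T (dom A b) × a ≢ b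
D A (true  , R[ i ] v) = T (rel A i v)
D A (false , R[ i ] v) = VAll.All (λ a → T (dom A a)) v × rel A i v ≡ false

instance
  codeℕ : Code ℕ
  codeℕ = record { ⌜_⌝ = λ n → n }

  codeBool : Code Bool
  codeBool = record { ⌜_⌝ = λ { false → 0 ; true → 1 } }

  codeVec : ∀ {n} → Code (Vec ℕ n)
  codeVec = record { ⌜_⌝ = go }
    where go : ∀ {n} → Vec ℕ n → ℕ
          go []       = 0
          go (x ∷ xs) = suc ⟪ x , go xs ⟫

  codeAtom : ∀ {L} → Code (Atom L)
  codeAtom = record { ⌜_⌝ = λ { (eq a b) → ⟪ 0 , ⟪ a , b ⟫ ⟫
                              ; (R[ i ] v) → ⟪ suc (toℕ i) , ⌜ v ⌝ ⟫ } }

  codeProd : ∀ {A B : Set} {{_ : Code A}} {{_ : Code B}} → Code (A × B)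
  codeProd = record { ⌜_⌝ = λ { (a , b) → ⟪ ⌜ a ⌝ , ⌜ b ⌝ ⟫ } }

  codeList : ∀ {A : Set} {{_ : Code A}} → Code (List A)
  codeList {A} = record { ⌜_⌝ = go }
    where go : List A → ℕ
          go []       = 0
          go (x ∷ xs) = suc ⟪ ⌜ x ⌝ , go xs ⟫

record AStr (L : Lang) : Set₁ where
  field
    Carrier : Set
    R       : (i : Fin (size L)) → Vec Carrier (arity L i) → Set
open AStr public

toAStr : ∀ {L} → Structure L → AStr L
toAStr A = record
  { Carrier = Σ ℕ (λ n → T (dom A n))
  ; R       = λ i v → T (rel A i (Vec.map proj₁ v)) }

_≅ᴬ_ : ∀ {L} → AStr L → AStr L → Set
_≅ᴬ_ {L} A B = Σ (Carrier A ↔ Carrier B) λ f →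
  ∀ (i : Fin (size L)) (v : Vec (Carrier A) (arity L i)) →
    R A i v ⇔ R B i (Vec.map (Inverse.to f) v)

_≅_ : ∀ {L} → Structure L → Structure L → Set
A ≅ B = toAStr A ≅ᴬ toAStr B

-- a class of structures (each class below is closed under ≅ by definition)
Class : Lang → Set₁
Class L = Structure L → Set

_⟶[_]_ : ∀ {L L'} → Structure L → (List (Literal L) → Literal L' → Set) →
         Structure L' → Set
A ⟶[ Φ ] B = ∀ φ → (∃[ α ] (LAll.All (D A) α × Φ α φ)) ⇔ D B φ

record Transformation {L L'} (K : Class L) (K' : Class L') : Set₁ where
  field
    Φ      : List (Literal L) → Literal L' → Set
    ce     : IsCE (λ (p : List (Literal L) × Literal L') → Φ (proj₁ p) (Data.Product.proj₂ p))
    finite : ∀ α φ → Φ α φ → ∃[ A ] (FiniteStr A × LAll.All (D A) α)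
    total  : ∀ A → K A → ∃[ B ] (K' B × A ⟶[ Φ ] B)
open Transformation public

record Embedding {L L'} (K : Class L) (K' : Class L') : Set₁ where
  field
    trans : Transformation K K'
    iso   : ∀ A A' B B' → K A → K A' →
            A ⟶[ Φ trans ] B → A' ⟶[ Φ trans ] B' →
            (A ≅ A' ⇔ B ≅ B')

_≤c_ : ∀ {L L'} → Class L → Class L' → Set₁
K ≤c K' = Embedding K K'

LO-Lang : Lang
LO-Lang = record { size = 1 ; arity = λ _ → 2 }

FinOrd : ℕ → AStr LO-Lang
FinOrd n = record { Carrier = Fin n ; R = λ { _ (x ∷ y ∷ []) → x Fin.< y } }

FLO : Class LO-Lang
FLO A = ∃[ n ] (toAStr A ≅ᴬ FinOrd n)

-- FVS : finite-dimensional ℚ-vector spaces, language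
-- {V, F, 0_F, 1_F, +_F, *_F, 0_V, +_V, *_V} (operations as graphs)

VS-arity : Fin 9 → ℕ
VS-arity Fin.zero = 1                                                   -- V
VS-arity (Fin.suc Fin.zero) = 1                                         -- F
VS-arity (Fin.suc (Fin.suc Fin.zero)) = 1                               -- 0_F
VS-arity (Fin.suc (Fin.suc (Fin.suc Fin.zero))) = 1                     -- 1_F
VS-arity (Fin.suc (Fin.suc (Fin.suc (Fin.suc Fin.zero)))) = 3           -- +_F
VS-arity (Fin.suc (Fin.suc (Fin.suc (Fin.suc (Fin.suc Fin.zero))))) = 3 -- *_F
VS-arity (Fin.suc (Fin.suc (Fin.suc (Fin.suc (Fin.suc (Fin.suc Fin.zero)))))) = 1 -- 0_V
VS-arity (Fin.suc (Fin.suc (Fin.suc (Fin.suc (Fin.suc (Fin.suc (Fin.suc Fin.zero))))))) = 3 -- +_V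
VS-arity (Fin.suc (Fin.suc (Fin.suc (Fin.suc (Fin.suc (Fin.suc (Fin.suc (Fin.suc Fin.zero)))))))) = 3 -- *_V

VS-Lang : Lang
VS-Lang = record { size = 9 ; arity = VS-arity }

-- the standard model ℚ^n: scalars inj₁, vectors inj₂
QVS-R : (n : ℕ) → (i : Fin 9) → Vec (ℚ ⊎ Vec ℚ n) (VS-arity i) → Set
QVS-R n Fin.zero (x ∷ []) = ∃[ v ] (x ≡ inj₂ v)
QVS-R n (Fin.suc Fin.zero) (x ∷ []) = ∃[ a ] (x ≡ inj₁ a)
QVS-R n (Fin.suc (Fin.suc Fin.zero)) (x ∷ []) = x ≡ inj₁ 0ℚ
QVS-R n (Fin.suc (Fin.suc (Fin.suc Fin.zero))) (x ∷ []) = x ≡ inj₁ 1ℚ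
QVS-R n (Fin.suc (Fin.suc (Fin.suc (Fin.suc Fin.zero)))) (x ∷ y ∷ z ∷ []) =
  ∃[ a ] ∃[ b ] (x ≡ inj₁ a × y ≡ inj₁ b × z ≡ inj₁ (a ℚ.+ b))
QVS-R n (Fin.suc (Fin.suc (Fin.suc (Fin.suc (Fin.suc Fin.zero))))) (x ∷ y ∷ z ∷ []) =
  ∃[ a ] ∃[ b ] (x ≡ inj₁ a × y ≡ inj₁ b × z ≡ inj₁ (a ℚ.* b))
QVS-R n (Fin.suc (Fin.suc (Fin.suc (Fin.suc (Fin.suc (Fin.suc Fin.zero)))))) (x ∷ []) =
  x ≡ inj₂ (Vec.replicate n 0ℚ)
QVS-R n (Fin.suc (Fin.suc (Fin.suc (Fin.suc (Fin.suc (Fin.suc (Fin.suc Fin.zero))))))) (x ∷ y ∷ z ∷ []) =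
  ∃[ u ] ∃[ v ] (x ≡ inj₂ u × y ≡ inj₂ v × z ≡ inj₂ (Vec.zipWith ℚ._+_ u v))
QVS-R n (Fin.suc (Fin.suc (Fin.suc (Fin.suc (Fin.suc (Fin.suc (Fin.suc (Fin.suc Fin.zero)))))))) (x ∷ y ∷ z ∷ []) =
  ∃[ a ] ∃[ v ] (x ≡ inj₁ a × y ≡ inj₂ v × z ≡ inj₂ (Vec.map (a ℚ.*_) v))

QVS : ℕ → AStr VS-Lang
QVS n = record { Carrier = ℚ ⊎ Vec ℚ n ; R = QVS-R n }

FVS : Class VS-Lang
FVS A = ∃[ n ] (toAStr A ≅ᴬ QVS n)

{-# OPTIONS --safe #-}
module Submission where

-- FLO ≤c FVS: a finite part of the diagram of a linear order tells whether there are at least k elements. The spaces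
-- ℚ⁰ ⊆ ℚ¹ ⊆ ℚ² ⊆ … have copies inside ω, each a substructure of the next, whose diagrams are computable uniformly in k.
-- So enumerate the diagram of the copy of ℚᵏ as soon as k elements have been seen; dimension is an isomorphism invariant.
--
-- FVS ≰c FLO: a transformation is monotone on diagrams, so ℚ¹ ⊆ ℚ² gives |Φ(ℚ¹)| ≤ |Φ(ℚ²)|. Conversely the finitely
-- many literals which put the elements into Φ(ℚ²) depend on finitely many literals of ℚ². These also hold in some copy
-- of ℚ¹, because the projection of the plane along a direction in general position is injective on any finite set; hence
-- |Φ(ℚ²)| ≤ |Φ(ℚ¹)|. Finite linear orders of the same size are isomorphic, but ℚ¹ and ℚ² are not.

open import Defs
open import Data.Nat
open import Data.Nat.Properties
open import Data.Nat.Induction using (<-rec)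
import Data.Integer as ℤ
import Data.Integer.Properties as ℤₚ
import Data.Integer.Solver
open import Data.Rational as ℚ using (ℚ; 0ℚ; 1ℚ; mkℚ; fromℚᵘ; toℚᵘ)
import Data.Rational.Properties as ℚₚ
import Data.Rational.Solver
open import Data.Rational.Unnormalised as ℚᵘ using (ℚᵘ; mkℚᵘ; *≡*)
import Data.Rational.Unnormalised.Properties as ℚᵘₚ
open import Algebra.Bundles using (CommutativeRing)
open import Algebra.Properties.Group ℚₚ.+-0-group using (x∙y⁻¹≈ε⇒x≈y)
import Algebra.Properties.Semiring.Sum as Sums
open import Data.Bool using (Bool; true; false; T)
open import Data.Bool.Properties using (T-irrelevant)
open import Data.Fin as Fin using (Fin; toℕ; fromℕ<; punchIn; punchOut)
open import Data.Fin.Properties as Finₚ using (any?; punchIn-punchOut; injective⇒≤; toℕ<n; toℕ-fromℕ<; toℕ-injective)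
open import Data.Fin.Permutation using (↔⇒≡)
open import Data.Fin.Patterns using (0F; 1F; 2F; 3F; 4F; 5F; 6F; 7F; 8F)
open import Data.Vec as Vec using (Vec; []; _∷_; lookup; tabulate; head; tail)
import Data.Vec.Properties as Vecₚ
open import Data.Vec.Relation.Unary.All as VAll using ([]; _∷_)
open import Data.List as List using (List; []; _∷_; _++_; concatMap; cartesianProduct)
open import Data.List.Properties using (length-tabulate)
open import Data.List.Membership.Propositional using (_∈_; lose; find)
open import Data.List.Membership.Propositional.Properties
  using (∈-map⁺; ∈-concatMap⁺; ∈-cartesianProduct⁺; ∈-++⁺ˡ; ∈-++⁺ʳ; ∈-lookup)
open import Data.List.Relation.Unary.All as LAll using ([]; _∷_)
import Data.List.Relation.Unary.All.Properties as LAllₚ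
open import Data.List.Relation.Unary.Any as LAny using (here; there)
open import Data.Product
open import Data.Sum as Sum using (_⊎_; inj₁; inj₂; [_,_])
import Data.Sum.Properties as Sumₚ
open import Data.Unit using (⊤)
open import Data.Empty
open import Function using (_∘_; id)
open import Function.Bundles using (_⇔_; mk⇔; Equivalence; _↔_; mk↔ₛ′; Inverse; Injection)
open import Function.Properties.Equivalence using () renaming (refl to ⇔-refl; sym to ⇔-sym; trans to ⇔-trans)
open import Function.Properties.Inverse using (↔-sym; ↔-trans; ↔⇒↣)
open import Relation.Binary.Definitions using (DecidableEquality; tri<; tri≈; tri>)
open import Relation.Binary.PropositionalEquality hiding ([_])
open import Relation.Nullary
open import Relation.Nullary.Decidable using (isYes; toWitness; fromWitness; map′; ¬?; _×-dec_; decidable-stable)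

open Equivalence using (to; from)

-- Computable enumerability refers to a concrete machine model, so the diagram of ℚᵏ has to be
-- decided by explicit programs with k as an input. The programs know only naturals: identities
-- between rationals become equations in ℕ with all negative terms moved across, and the relations
-- of the space become bounded statements about codes. The nesting of the spaces comes from the
-- pairing function: since ⟪ 0 , 0 ⟫ = 0, trailing zero coordinates do not change the code of a
-- vector. In the other direction, injectivity on the named elements is not enough. A negated
-- literal saying that z differs from u + v must survive the projection, and u + v may be an element
-- that no literal names; so such sums, multiples and the zero vector enter the finite set of points
-- to be kept apart. Moreover the literals speak of fixed elements of ω, so the line must be
-- renumbered to carry exactly these. An isomorphism of the two-sorted structures may also move the
-- scalars, so invariance of dimension is proved for maps that are linear up to a map of scalars.

private
  module ℤS = Data.Integer.Solver.+-*-Solver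
  module ℚS = Data.Rational.Solver.+-*-Solver

-- Computable functions and predicates

record Computable {n} (f : Vec ℕ n → ℕ) : Set where
  field
    program  : PR n
    computes : ∀ ρ → program [ ρ ]⇓ f ρ
open Computable

var : ∀ {n} (i : Fin n) → Computable (λ ρ → lookup ρ i)
var i = record { program = proj i ; computes = λ _ → ⇓proj }

sucᶜ : ∀ {n} {f : Vec ℕ n → ℕ} → Computable f → Computable (λ ρ → suc (f ρ))
sucᶜ c = record { program = comp succ (program c ∷ []) ; computes = λ ρ → ⇓comp (computes c ρ ∷ []) ⇓succ }

lit : ∀ {n} k → Computable {n} (λ _ → k)
lit zero    = record { program = zer ; computes = λ _ → ⇓zer }
lit (suc k) = sucᶜ (lit k)

projections : ∀ {n m} → (Fin m → Fin n) → Vec (PR n) m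
projections σ = tabulate (λ i → proj (σ i))

projections-compute : ∀ {n m} (σ : Fin m → Fin n) ρ →
                      projections σ [ ρ ]⇓* tabulate (λ i → lookup ρ (σ i))
projections-compute {m = zero}  σ ρ = []
projections-compute {m = suc m} σ ρ = ⇓proj ∷ projections-compute (λ i → σ (Fin.suc i)) ρ

natrec : ℕ → (ℕ → ℕ → ℕ) → ℕ → ℕ
natrec z s zero    = z
natrec z s (suc k) = s k (natrec z s k)

primrec : ∀ {n} {t b : Vec ℕ n → ℕ} {s : Vec ℕ (2 + n) → ℕ} →
          Computable t → Computable b → Computable s →
          Computable (λ ρ → natrec (b ρ) (λ k z → s (k ∷ z ∷ ρ)) (t ρ))
primrec {n} {t} {b} {s} ct cb cs = record
  { program  = comp (prec (program cb) (program cs)) (program ct ∷ projections id)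
  ; computes = λ ρ → ⇓comp (computes ct ρ ∷ all ρ) (run ρ (t ρ)) }
  where
  all : ∀ ρ → projections id [ ρ ]⇓* ρ
  all ρ = subst (projections id [ ρ ]⇓*_) (Vecₚ.tabulate∘lookup ρ) (projections-compute id ρ)
  run : ∀ ρ k → prec (program cb) (program cs) [ k ∷ ρ ]⇓ natrec (b ρ) (λ k z → s (k ∷ z ∷ ρ)) k
  run ρ zero    = ⇓prec0 (computes cb ρ)
  run ρ (suc k) = ⇓precS (run ρ k) (computes cs _)

weaken : ∀ {n} {f : Vec ℕ n → ℕ} → Computable f → Computable (λ ρ → f (tail ρ))
weaken {f = f} c = record
  { program  = comp (program c) (projections Fin.suc)
  ; computes = λ { (x ∷ ρ) → ⇓comp
      (subst (projections Fin.suc [ x ∷ ρ ]⇓*_) (Vecₚ.tabulate∘lookup ρ) (projections-compute Fin.suc (x ∷ ρ)))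
      (computes c ρ) } }

-- A step function of `primrec` receives the counter and the accumulator in front of the parameters;
-- a body that mentions only counter and parameters has to jump over the accumulator.
skip₁ : ∀ {n} {f : Vec ℕ (suc n) → ℕ} → Computable f →
        Computable (λ ρ → f (head ρ ∷ tail (tail ρ)))
skip₁ {f = f} c = record
  { program  = comp (program c) (proj Fin.zero ∷ projections (λ i → Fin.suc (Fin.suc i)))
  ; computes = λ { (x ∷ y ∷ ρ) → ⇓comp
      (⇓proj ∷ subst (projections (λ i → Fin.suc (Fin.suc i)) [ x ∷ y ∷ ρ ]⇓*_) (Vecₚ.tabulate∘lookup ρ)
         (projections-compute (λ i → Fin.suc (Fin.suc i)) (x ∷ y ∷ ρ)))
      (computes c (x ∷ ρ)) } }

castᶜ : ∀ {n} {f g : Vec ℕ n → ℕ} → (∀ ρ → f ρ ≡ g ρ) → Computable f → Computable g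
castᶜ eqv c = record { program = program c ; computes = λ ρ → subst (program c [ ρ ]⇓_) (eqv ρ) (computes c ρ) }

private variable
  n : ℕ
  f g h : Vec ℕ n → ℕ

infixl 6 _+ᶜ_ _∸ᶜ_
infixl 7 _*ᶜ_

_+ᶜ_ : Computable f → Computable g → Computable (λ ρ → f ρ + g ρ)
_+ᶜ_ {f = f} {g} cf cg = castᶜ (λ ρ → lemma (g ρ) (f ρ)) (primrec cf cg (sucᶜ (var (Fin.suc Fin.zero))))
  where
  lemma : ∀ z k → natrec z (λ _ z → suc z) k ≡ k + z
  lemma z zero    = refl
  lemma z (suc k) = cong suc (lemma z k)

_*ᶜ_ : Computable f → Computable g → Computable (λ ρ → f ρ * g ρ)
_*ᶜ_ {f = f} {g} cf cg = castᶜ (λ ρ → lemma (g ρ) (f ρ))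
  (primrec cf (lit 0) (weaken (weaken cg) +ᶜ var (Fin.suc Fin.zero)))
  where
  lemma : ∀ y k → natrec 0 (λ _ z → y + z) k ≡ k * y
  lemma y zero    = refl
  lemma y (suc k) = cong (y +_) (lemma y k)

_^ᶜ_ : Computable f → Computable g → Computable (λ ρ → f ρ ^ g ρ)
_^ᶜ_ {f = f} {g} cf cg = castᶜ (λ ρ → lemma (f ρ) (g ρ))
  (primrec cg (lit 1) (weaken (weaken cf) *ᶜ var (Fin.suc Fin.zero)))
  where
  lemma : ∀ x k → natrec 1 (λ _ z → x * z) k ≡ x ^ k
  lemma x zero    = refl
  lemma x (suc k) = cong (x *_) (lemma x k)

predᶜ : Computable f → Computable (λ ρ → pred (f ρ))
predᶜ {f = f} cf = castᶜ (λ ρ → lemma (f ρ)) (primrec cf (lit 0) (var Fin.zero))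
  where
  lemma : ∀ k → natrec 0 (λ k _ → k) k ≡ pred k
  lemma zero    = refl
  lemma (suc k) = refl

_∸ᶜ_ : Computable f → Computable g → Computable (λ ρ → f ρ ∸ g ρ)
_∸ᶜ_ {f = f} {g} cf cg = castᶜ (λ ρ → lemma (f ρ) (g ρ)) (primrec cg cf (predᶜ (var (Fin.suc Fin.zero))))
  where
  lemma : ∀ x k → natrec x (λ _ z → pred z) k ≡ x ∸ k
  lemma x zero    = refl
  lemma x (suc k) = trans (cong pred (lemma x k)) (pred[m∸n]≡m∸[1+n] x k)

-- The value 0 of the characteristic function stands for truth, as in the halting condition of mu.
record Decidableᶜ {n} (P : Vec ℕ n → Set) : Set where
  field
    {χ}        : Vec ℕ n → ℕ
    computable : Computable χ
    correct    : ∀ ρ → χ ρ ≡ 0 ⇔ P ρ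
open Decidableᶜ

private variable
  P Q : Vec ℕ n → Set

mapᵈ : (∀ ρ → P ρ ⇔ Q ρ) → Decidableᶜ P → Decidableᶜ Q
mapᵈ eqv d = record { computable = computable d ; correct = λ ρ → ⇔-trans (correct d ρ) (eqv ρ) }

decideᵈ : Decidableᶜ P → ∀ ρ → Dec (P ρ)
decideᵈ d ρ with χ d ρ ≟ 0
... | yes p = yes (to (correct d ρ) p)
... | no ¬p = no (λ p → ¬p (from (correct d ρ) p))

infix  5 _≡ᶜ_
infixr 4 _∧ᶜ_
infixr 3 _∨ᶜ_

-- As truth is the value 0, sums act as conjunctions and products as disjunctions. Equality is the
-- conjunction of two inequalities, each tested by a truncated difference.
_≡ᶜ_ : Computable f → Computable g → Decidableᶜ (λ ρ → f ρ ≡ g ρ)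
_≡ᶜ_ {f = f} {g} cf cg = record
  { computable = (cf ∸ᶜ cg) +ᶜ (cg ∸ᶜ cf)
  ; correct    = λ ρ → mk⇔
      (λ e → ≤-antisym (m∸n≡0⇒m≤n (m+n≡0⇒m≡0 (f ρ ∸ g ρ) e)) (m∸n≡0⇒m≤n (m+n≡0⇒n≡0 (f ρ ∸ g ρ) e)))
      (λ e → cong₂ _+_ (m≤n⇒m∸n≡0 (≤-reflexive e)) (m≤n⇒m∸n≡0 (≤-reflexive (sym e)))) }

_∧ᶜ_ : Decidableᶜ P → Decidableᶜ Q → Decidableᶜ (λ ρ → P ρ × Q ρ)
p ∧ᶜ q = record
  { computable = computable p +ᶜ computable q
  ; correct    = λ ρ → mk⇔
      (λ e → to (correct p ρ) (m+n≡0⇒m≡0 (χ p ρ) e) , to (correct q ρ) (m+n≡0⇒n≡0 (χ p ρ) e))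
      (λ (a , b) → cong₂ _+_ (from (correct p ρ) a) (from (correct q ρ) b)) }

_∨ᶜ_ : Decidableᶜ P → Decidableᶜ Q → Decidableᶜ (λ ρ → P ρ ⊎ Q ρ)
p ∨ᶜ q = record
  { computable = computable p *ᶜ computable q
  ; correct    = λ ρ → mk⇔
      (λ e → Sum.map (to (correct p ρ)) (to (correct q ρ)) (m*n≡0⇒m≡0∨n≡0 (χ p ρ) e))
      [ (λ a → cong (_* χ q ρ) (from (correct p ρ) a))
      , (λ b → trans (cong (χ p ρ *_) (from (correct q ρ) b)) (*-zeroʳ (χ p ρ))) ] }

¬ᶜ_ : Decidableᶜ P → Decidableᶜ (λ ρ → ¬ P ρ)
¬ᶜ p = record
  { computable = lit 1 ∸ᶜ computable p
  ; correct    = λ ρ → mk⇔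
      (λ e a → 1+n≰n (≤-trans (m∸n≡0⇒m≤n e) (≤-reflexive (from (correct p ρ) a))))
      (λ ¬a → m≤n⇒m∸n≡0 (n≢0⇒n>0 (λ e → ¬a (to (correct p ρ) e)))) }

∀<ᶜ : Computable f → Decidableᶜ P → Decidableᶜ (λ ρ → ∀ k → k < f ρ → P (k ∷ ρ))
∀<ᶜ {f = f} {P = P} cf p = record
  { computable = primrec cf (lit 0) (skip₁ (computable p) +ᶜ var (Fin.suc Fin.zero))
  ; correct    = λ ρ → mk⇔ (sound ρ (f ρ)) (complete ρ (f ρ)) }
  where
  defects : ∀ ρ → ℕ → ℕ
  defects ρ = natrec 0 (λ k z → χ p (k ∷ ρ) + z)
  sound : ∀ ρ m → defects ρ m ≡ 0 → ∀ k → k < m → P (k ∷ ρ)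
  sound ρ (suc m) e k k<m with m≤n⇒m<n∨m≡n (s≤s⁻¹ k<m)
  ... | inj₁ k<m′ = sound ρ m (m+n≡0⇒n≡0 (χ p (m ∷ ρ)) e) k k<m′
  ... | inj₂ refl = to (correct p _) (m+n≡0⇒m≡0 (χ p (m ∷ ρ)) e)
  complete : ∀ ρ m → (∀ k → k < m → P (k ∷ ρ)) → defects ρ m ≡ 0
  complete ρ zero    all = refl
  complete ρ (suc m) all = cong₂ _+_ (from (correct p _) (all m ≤-refl))
                                     (complete ρ m (λ k k<m → all k (m<n⇒m<1+n k<m)))

-- The program only refutes the bounded universal statement; `search` recovers a witness by trying
-- the finitely many candidates, since the body is decidable.
∃<ᶜ : Computable f → Decidableᶜ P → Decidableᶜ (λ ρ → ∃ λ k → k < f ρ × P (k ∷ ρ))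
∃<ᶜ {f = f} {P = P} cf p = mapᵈ (λ ρ → mk⇔ (search ρ (f ρ)) (λ (k , k<f , a) all → all k k<f a))
                                (¬ᶜ ∀<ᶜ cf (¬ᶜ p))
  where
  search : ∀ ρ m → ¬ (∀ k → k < m → ¬ P (k ∷ ρ)) → ∃ λ k → k < m × P (k ∷ ρ)
  search ρ zero    ¬all = ⊥-elim (¬all (λ k ()))
  search ρ (suc m) ¬all with decideᵈ p (m ∷ ρ)
  ... | yes a = m , ≤-refl , a
  ... | no ¬a = let k , k<m , a = search ρ m (λ all → ¬all (λ k k<1+m → below all k (s≤s⁻¹ k<1+m)))
                in k , m<n⇒m<1+n k<m , a
    where
    below : (∀ k → k < m → ¬ P (k ∷ ρ)) → ∀ k → k ≤ m → ¬ P (k ∷ ρ)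
    below all k k≤m with m≤n⇒m<n∨m≡n k≤m
    ... | inj₁ k<m  = all k k<m
    ... | inj₂ refl = ¬a

-- A decidable graph makes minimisation total: the search ends because the value exists, and each
-- smaller candidate fails because the graph determines the value. This yields the inverses of
-- pairing.
the : Decidableᶜ (λ ρ → head ρ ≡ f (tail ρ)) → Computable f
the {f = f} d = record
  { program  = mu (program (computable d))
  ; computes = λ ρ → ⇓mu
      (subst (program (computable d) [ f ρ ∷ ρ ]⇓_) (from (correct d _) refl) (computes (computable d) _))
      (λ k k<f → before ρ k k<f) }
  where
  before : ∀ ρ k → k < f ρ → ∃[ m ] (program (computable d) [ k ∷ ρ ]⇓ suc m)
  before ρ k k<f with χ d (k ∷ ρ) in e
  ... | zero  = ⊥-elim (<-irrefl (to (correct d _) e) k<f)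
  ... | suc m = m , subst (program (computable d) [ k ∷ ρ ]⇓_) e (computes (computable d) _)

-- Off the set the program must diverge. The characteristic function ignores the variable of the
-- search, so minimisation stops at 0 on the set and finds nothing elsewhere.
decidable⇒CE : ∀ {A : Set} {{_ : Code A}} {P : A → Set} {Q : Vec ℕ 1 → Set} →
               Decidableᶜ Q → (∀ x → P x ⇔ Q (⌜ x ⌝ ∷ [])) → IsCE P
decidable⇒CE {P = P} d eqv = mu (program (weaken (computable d))) , λ x → ⇔-trans (eqv x) (mk⇔
  (λ q → 0 , ⇓mu (subst (program (weaken (computable d)) [ 0 ∷ ⌜ x ⌝ ∷ [] ]⇓_) (from (correct d _) q)
                        (computes (weaken (computable d)) _)) (λ k ()))
  (λ { (y , ⇓mu r _) → to (correct d _) (deterministic (computes (weaken (computable d)) _) r) }))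
  where
  mutual
    deterministic : ∀ {n} {c : PR n} {ρ x y} → c [ ρ ]⇓ x → c [ ρ ]⇓ y → x ≡ y
    deterministic ⇓zer ⇓zer = refl
    deterministic ⇓succ ⇓succ = refl
    deterministic ⇓proj ⇓proj = refl
    deterministic (⇓comp as a) (⇓comp bs b) with deterministic* as bs
    ... | refl = deterministic a b
    deterministic (⇓prec0 a) (⇓prec0 b) = deterministic a b
    deterministic (⇓precS a a′) (⇓precS b b′) with deterministic a b
    ... | refl = deterministic a′ b′
    deterministic {x = x} {y} (⇓mu a as) (⇓mu b bs) with <-cmp x y
    ... | tri≈ _ e _ = e
    ... | tri< x<y _ _ with deterministic a (proj₂ (bs x x<y))
    ...   | ()
    deterministic {x = x} {y} (⇓mu a as) (⇓mu b bs) | tri> _ _ y<x with deterministic b (proj₂ (as y y<x))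
    ...   | ()
    deterministic* : ∀ {n m} {cs : Vec (PR n) m} {ρ xs ys} → cs [ ρ ]⇓* xs → cs [ ρ ]⇓* ys → xs ≡ ys
    deterministic* []       []       = refl
    deterministic* (a ∷ as) (b ∷ bs) = cong₂ _∷_ (deterministic a b) (deterministic* as bs)

-- Pairing, lists and sequences

⟪0,b⟫ : ∀ b → ⟪ 0 , b ⟫ ≡ 2 * b
⟪0,b⟫ b = +-identityʳ (2 * b)

⟪1+a,b⟫ : ∀ a b → ⟪ suc a , b ⟫ ≡ suc (2 * ⟪ a , b ⟫)
⟪1+a,b⟫ a b = begin
  2 * 2 ^ a * suc (2 * b) ∸ 1     ≡⟨ cong (_∸ 1) (*-assoc 2 (2 ^ a) (suc (2 * b))) ⟩
  2 * (2 ^ a * suc (2 * b)) ∸ 1   ≡⟨ cong (λ x → 2 * x ∸ 1) (sym (suc-pred (2 ^ a * suc (2 * b)))) ⟩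
  2 * suc ⟪ a , b ⟫ ∸ 1           ≡⟨ cong (_∸ 1) (*-suc 2 ⟪ a , b ⟫) ⟩
  suc (2 * ⟪ a , b ⟫)             ∎
  where
  open ≡-Reasoning
  instance
    _ : NonZero (2 ^ a)
    _ = m^n≢0 2 a
    _ : NonZero (2 ^ a * suc (2 * b))
    _ = m*n≢0 (2 ^ a) (suc (2 * b))

-- Parity tells whether the first component is 0; an odd code is halved and the argument repeated.
⟪⟫-injective : ∀ a b c d → ⟪ a , b ⟫ ≡ ⟪ c , d ⟫ → a ≡ c × b ≡ d
⟪⟫-injective zero    b zero    d e =
  refl , *-cancelˡ-≡ b d 2 (trans (sym (⟪0,b⟫ b)) (trans e (⟪0,b⟫ d)))
⟪⟫-injective zero    b (suc c) d e =
  ⊥-elim (even≢odd b ⟪ c , d ⟫ (trans (sym (⟪0,b⟫ b)) (trans e (⟪1+a,b⟫ c d))))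
⟪⟫-injective (suc a) b zero    d e =
  ⊥-elim (even≢odd d ⟪ a , b ⟫ (trans (sym (⟪0,b⟫ d)) (trans (sym e) (⟪1+a,b⟫ a b))))
⟪⟫-injective (suc a) b (suc c) d e =
  map₁ (cong suc) (⟪⟫-injective a b c d
    (*-cancelˡ-≡ ⟪ a , b ⟫ ⟪ c , d ⟫ 2 (suc-injective (trans (sym (⟪1+a,b⟫ a b)) (trans e (⟪1+a,b⟫ c d))))))

even⊎odd : ∀ n → ∃[ k ] (n ≡ 2 * k ⊎ n ≡ suc (2 * k))
even⊎odd zero = 0 , inj₁ refl
even⊎odd (suc n) with even⊎odd n
... | k , inj₁ e = k , inj₂ (cong suc e)
... | k , inj₂ e = suc k , inj₁ (trans (cong suc e) (sym (*-suc 2 k)))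

abstract
  -- The first component counts the trailing ones of n in binary; behind them stand a 0 and the
  -- binary digits of the second.
  unpair : ∀ n → ∃₂ λ a b → ⟪ a , b ⟫ ≡ n
  unpair = <-rec _ λ n rec → step n rec (even⊎odd n)
    where
    step : ∀ n → (∀ {m} → m < n → ∃₂ λ a b → ⟪ a , b ⟫ ≡ m) →
           ∃[ k ] (n ≡ 2 * k ⊎ n ≡ suc (2 * k)) → ∃₂ λ a b → ⟪ a , b ⟫ ≡ n
    step n rec (k , inj₁ e)    = 0 , k , trans (⟪0,b⟫ k) (sym e)
    step n rec (k , inj₂ refl) with rec {k} (s≤s (m≤m+n k (k + 0)))
    ... | a , b , p = suc a , b , trans (⟪1+a,b⟫ a b) (cong (λ x → suc (2 * x)) p)

π₁ π₂ : ℕ → ℕ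
π₁ n = proj₁ (unpair n)
π₂ n = proj₁ (proj₂ (unpair n))

⟪π₁,π₂⟫ : ∀ n → ⟪ π₁ n , π₂ n ⟫ ≡ n
⟪π₁,π₂⟫ n = proj₂ (proj₂ (unpair n))

π₁-⟪⟫ : ∀ a b → π₁ ⟪ a , b ⟫ ≡ a
π₁-⟪⟫ a b = proj₁ (⟪⟫-injective (π₁ ⟪ a , b ⟫) (π₂ ⟪ a , b ⟫) a b (⟪π₁,π₂⟫ ⟪ a , b ⟫))

π₂-⟪⟫ : ∀ a b → π₂ ⟪ a , b ⟫ ≡ b
π₂-⟪⟫ a b = proj₂ (⟪⟫-injective (π₁ ⟪ a , b ⟫) (π₂ ⟪ a , b ⟫) a b (⟪π₁,π₂⟫ ⟪ a , b ⟫))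

π₁-0 : π₁ 0 ≡ 0
π₁-0 = π₁-⟪⟫ 0 0

π₂-0 : π₂ 0 ≡ 0
π₂-0 = π₂-⟪⟫ 0 0

b≤⟪a,b⟫ : ∀ a b → b ≤ ⟪ a , b ⟫
b≤⟪a,b⟫ zero    b = subst (b ≤_) (sym (⟪0,b⟫ b)) (m≤m+n _ _)
b≤⟪a,b⟫ (suc a) b = subst (b ≤_) (sym (⟪1+a,b⟫ a b)) (m≤n⇒m≤1+n (≤-trans (b≤⟪a,b⟫ a b) (m≤m+n _ _)))

⟪_,_⟫ᶜ : Computable f → Computable g → Computable (λ ρ → ⟪ f ρ , g ρ ⟫)
⟪ cf , cg ⟫ᶜ = ((lit 2 ^ᶜ cf) *ᶜ sucᶜ (lit 2 *ᶜ cg)) ∸ᶜ lit 1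

-- No second component exceeds the code of its pair, so the graph needs only a bounded search.
π₁ᶜ : Computable f → Computable (λ ρ → π₁ (f ρ))
π₁ᶜ {f = f} cf = the (mapᵈ graph
    (∃<ᶜ (sucᶜ (weaken cf)) (⟪ var 1F , var 0F ⟫ᶜ ≡ᶜ weaken (weaken cf))))
  where
  graph : ∀ ρ → (∃ λ b → b < suc (f (tail ρ)) × ⟪ lookup ρ 0F , b ⟫ ≡ f (tail ρ)) ⇔ (head ρ ≡ π₁ (f (tail ρ)))
  graph (a ∷ ρ) = mk⇔
    (λ (b , _ , e) → trans (sym (π₁-⟪⟫ a b)) (cong π₁ e))
    (λ { refl → π₂ (f ρ)
       , s≤s (subst (π₂ (f ρ) ≤_) (⟪π₁,π₂⟫ (f ρ)) (b≤⟪a,b⟫ (π₁ (f ρ)) _))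
       , ⟪π₁,π₂⟫ (f ρ) })

π₂ᶜ : Computable f → Computable (λ ρ → π₂ (f ρ))
π₂ᶜ {f = f} cf = the (mapᵈ graph (⟪ π₁ᶜ (weaken cf) , var 0F ⟫ᶜ ≡ᶜ weaken cf))
  where
  graph : ∀ ρ → ⟪ π₁ (f (tail ρ)) , lookup ρ 0F ⟫ ≡ f (tail ρ) ⇔ (head ρ ≡ π₂ (f (tail ρ)))
  graph (b ∷ ρ) = mk⇔
    (λ e → trans (sym (π₂-⟪⟫ (π₁ (f ρ)) b)) (cong π₂ e))
    (λ e → trans (cong (λ b → ⟪ π₁ (f ρ) , b ⟫) e) (⟪π₁,π₂⟫ (f ρ)))

-- Lists and vectors are coded by [] ↦ 0 and x ∷ xs ↦ suc ⟪ x , xs ⟫.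
suffix : ℕ → ℕ → ℕ
suffix l = natrec l (λ _ z → π₂ (pred z))

item : ℕ → ℕ → ℕ
item l i = π₁ (pred (suffix l i))

suffix-∷ : ∀ x l i → suffix (suc ⟪ x , l ⟫) (suc i) ≡ suffix l i
suffix-∷ x l zero    = π₂-⟪⟫ x l
suffix-∷ x l (suc i) = cong (π₂ ∘ pred) (suffix-∷ x l i)

item-∷ : ∀ x l i → item (suc ⟪ x , l ⟫) (suc i) ≡ item l i
item-∷ x l i = cong (π₁ ∘ pred) (suffix-∷ x l i)

suffixᶜ : Computable f → Computable g → Computable (λ ρ → suffix (f ρ) (g ρ))
suffixᶜ cf cg = primrec cg cf (π₂ᶜ (predᶜ (var 1F)))

itemᶜ : Computable f → Computable g → Computable (λ ρ → item (f ρ) (g ρ))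
itemᶜ cf cg = π₁ᶜ (predᶜ (suffixᶜ cf cg))

-- A number also codes a finitely supported sequence, by head π₁ and tail π₂; the zero sequence is 0 = ⟪ 0 , 0 ⟫.
nthTail : ℕ → ℕ → ℕ
nthTail v = natrec v (λ _ z → π₂ z)

nth : ℕ → ℕ → ℕ
nth v i = π₁ (nthTail v i)

nthTail-suc : ∀ v i → nthTail v (suc i) ≡ nthTail (π₂ v) i
nthTail-suc v zero    = refl
nthTail-suc v (suc i) = cong π₂ (nthTail-suc v i)

nthTailᶜ : Computable f → Computable g → Computable (λ ρ → nthTail (f ρ) (g ρ))
nthTailᶜ cf cg = primrec cg cf (π₂ᶜ (var 1F))

nthᶜ : Computable f → Computable g → Computable (λ ρ → nth (f ρ) (g ρ))
nthᶜ cf cg = π₁ᶜ (nthTailᶜ cf cg)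

-- The length is described by the first empty suffix rather than computed. The description has at
-- most one solution, so a number found by search must be the length of the list that was coded.
IsLength : ℕ → ℕ → Set
IsLength l k = (∀ i → i < k → suffix l i ≢ 0) × suffix l k ≡ 0

isLength-unique : ∀ {l k k′} → IsLength l k → IsLength l k′ → k ≡ k′
isLength-unique {l} {k} {k′} (a , e) (a′ , e′) =
  ≤-antisym (≮⇒≥ (λ k′<k → a k′ k′<k e′)) (≮⇒≥ (λ k<k′ → a′ k k<k′ e))

module _ {A : Set} {{_ : Code A}} where

  length-isLength : ∀ (xs : List A) → IsLength ⌜ xs ⌝ (List.length xs)
  length-isLength []       = (λ i ()) , refl
  length-isLength (x ∷ xs) =
    (λ { zero    _         ()
       ; (suc i) (s≤s i<n) e → proj₁ (length-isLength xs) i i<n (trans (sym (suffix-∷ ⌜ x ⌝ ⌜ xs ⌝ i)) e) }) ,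
    trans (suffix-∷ ⌜ x ⌝ ⌜ xs ⌝ (List.length xs)) (proj₂ (length-isLength xs))

  length≤⌜⌝ : ∀ (xs : List A) → List.length xs ≤ ⌜ xs ⌝
  length≤⌜⌝ []       = z≤n
  length≤⌜⌝ (x ∷ xs) = s≤s (≤-trans (length≤⌜⌝ xs) (b≤⟪a,b⟫ ⌜ x ⌝ ⌜ xs ⌝))

  item-lookup : ∀ (xs : List A) i → item ⌜ xs ⌝ (toℕ i) ≡ ⌜ List.lookup xs i ⌝
  item-lookup (x ∷ xs) Fin.zero    = π₁-⟪⟫ ⌜ x ⌝ ⌜ xs ⌝
  item-lookup (x ∷ xs) (Fin.suc i) = trans (item-∷ ⌜ x ⌝ ⌜ xs ⌝ (toℕ i)) (item-lookup xs i)

-- Codes of rational numbers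

fraction : ℕ → ℕ → ℕ → ℚᵘ
fraction p m d = mkℚᵘ (ℤ.+ p ℤ.+ ℤ.- (ℤ.+ m)) d

-- The number ⟪ p , ⟪ m , d ⟫ ⟫ stands for the rational (p − m) / (1 + d).
unnormalised : ℕ → ℚᵘ
unnormalised c = fraction (π₁ c) (π₁ (π₂ c)) (π₂ (π₂ c))

rational : ℕ → ℚ
rational c = fromℚᵘ (unnormalised c)

fromℚᵘ-≡ : ∀ {p q} → fromℚᵘ p ≡ fromℚᵘ q ⇔ p ℚᵘ.≃ q
fromℚᵘ-≡ = mk⇔ ℚₚ.fromℚᵘ-injective ℚₚ.fromℚᵘ-cong

fromℚᵘ-+ : ∀ p q → fromℚᵘ p ℚ.+ fromℚᵘ q ≡ fromℚᵘ (p ℚᵘ.+ q)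
fromℚᵘ-+ p q = ℚₚ.toℚᵘ-injective (begin
  toℚᵘ (fromℚᵘ p ℚ.+ fromℚᵘ q)            ≈⟨ ℚₚ.toℚᵘ-homo-+ (fromℚᵘ p) (fromℚᵘ q) ⟩
  toℚᵘ (fromℚᵘ p) ℚᵘ.+ toℚᵘ (fromℚᵘ q)    ≈⟨ ℚᵘₚ.+-cong (ℚₚ.toℚᵘ-fromℚᵘ p) (ℚₚ.toℚᵘ-fromℚᵘ q) ⟩
  p ℚᵘ.+ q                                ≈⟨ ℚₚ.toℚᵘ-fromℚᵘ (p ℚᵘ.+ q) ⟨
  toℚᵘ (fromℚᵘ (p ℚᵘ.+ q))                ∎)
  where open import Relation.Binary.Reasoning.Setoid ℚᵘₚ.≃-setoid

fromℚᵘ-* : ∀ p q → fromℚᵘ p ℚ.* fromℚᵘ q ≡ fromℚᵘ (p ℚᵘ.* q)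
fromℚᵘ-* p q = ℚₚ.toℚᵘ-injective (begin
  toℚᵘ (fromℚᵘ p ℚ.* fromℚᵘ q)            ≈⟨ ℚₚ.toℚᵘ-homo-* (fromℚᵘ p) (fromℚᵘ q) ⟩
  toℚᵘ (fromℚᵘ p) ℚᵘ.* toℚᵘ (fromℚᵘ q)    ≈⟨ ℚᵘₚ.*-cong (ℚₚ.toℚᵘ-fromℚᵘ p) (ℚₚ.toℚᵘ-fromℚᵘ q) ⟩
  p ℚᵘ.* q                                ≈⟨ ℚₚ.toℚᵘ-fromℚᵘ (p ℚᵘ.* q) ⟨
  toℚᵘ (fromℚᵘ (p ℚᵘ.* q))                ∎)
  where open import Relation.Binary.Reasoning.Setoid ℚᵘₚ.≃-setoid

≃-cross : ∀ {p q} → (ℚᵘ.↥ p ℤ.* ℚᵘ.↧ q ≡ ℚᵘ.↥ q ℤ.* ℚᵘ.↧ p) ⇔ p ℚᵘ.≃ q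
≃-cross = mk⇔ *≡* (λ { (*≡* e) → e })

-- Programs compute in ℕ, rational arithmetic in ℤ: an integer equation is tested after its
-- subtracted terms have been brought to the other side.
≡-balance : ∀ {i j} {a b : ℕ} → i ℤ.+ ℤ.- j ≡ ℤ.+ a ℤ.+ ℤ.- (ℤ.+ b) → a ≡ b ⇔ i ≡ j
≡-balance {i} {j} {a} e = mk⇔
  (λ { refl → ℤₚ.i-j≡0⇒i≡j i j (trans e (ℤₚ.i≡j⇒i-j≡0 {ℤ.+ a} refl)) })
  (λ { refl → ℤₚ.+-injective (ℤₚ.i-j≡0⇒i≡j _ _ (trans (sym e) (ℤₚ.i≡j⇒i-j≡0 {i} refl))) })

pos-*₃ : ∀ a b c → ℤ.+ (a * b * c) ≡ ℤ.+ a ℤ.* ℤ.+ b ℤ.* ℤ.+ c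
pos-*₃ a b c = trans (ℤₚ.pos-* (a * b) c) (cong (ℤ._* ℤ.+ c) (ℤₚ.pos-* a b))

fraction-≃ : ∀ p₁ m₁ d₁ p₂ m₂ d₂ →
  p₁ * suc d₂ + m₂ * suc d₁ ≡ p₂ * suc d₁ + m₁ * suc d₂ ⇔ fraction p₁ m₁ d₁ ℚᵘ.≃ fraction p₂ m₂ d₂
fraction-≃ p₁ m₁ d₁ p₂ m₂ d₂ = ⇔-trans (≡-balance (begin
  (ℤ.+ p₁ ℤ.+ ℤ.- (ℤ.+ m₁)) ℤ.* ℤ.+ D₂ ℤ.+ ℤ.- ((ℤ.+ p₂ ℤ.+ ℤ.- (ℤ.+ m₂)) ℤ.* ℤ.+ D₁)
    ≡⟨ ℤS.solve 6 (λ p₁ m₁ D₁ p₂ m₂ D₂ →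
         (p₁ :+ :- m₁) :* D₂ :+ :- ((p₂ :+ :- m₂) :* D₁) :=
         (p₁ :* D₂ :+ m₂ :* D₁) :+ :- (p₂ :* D₁ :+ m₁ :* D₂))
       refl (ℤ.+ p₁) (ℤ.+ m₁) (ℤ.+ D₁) (ℤ.+ p₂) (ℤ.+ m₂) (ℤ.+ D₂) ⟩
  (ℤ.+ p₁ ℤ.* ℤ.+ D₂ ℤ.+ ℤ.+ m₂ ℤ.* ℤ.+ D₁) ℤ.+ ℤ.- (ℤ.+ p₂ ℤ.* ℤ.+ D₁ ℤ.+ ℤ.+ m₁ ℤ.* ℤ.+ D₂)
    ≡⟨ cong₂ (λ x y → x ℤ.+ ℤ.- y)
         (cong₂ ℤ._+_ (ℤₚ.pos-* p₁ D₂) (ℤₚ.pos-* m₂ D₁))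
         (cong₂ ℤ._+_ (ℤₚ.pos-* p₂ D₁) (ℤₚ.pos-* m₁ D₂)) ⟨
  ℤ.+ (p₁ * D₂ + m₂ * D₁) ℤ.+ ℤ.- (ℤ.+ (p₂ * D₁ + m₁ * D₂)) ∎)) ≃-cross
  where
  open ≡-Reasoning
  open ℤS using (_:+_; _:*_; :-_; _:=_)
  D₁ D₂ : ℕ
  D₁ = suc d₁
  D₂ = suc d₂

fraction-+ : ∀ p₁ m₁ d₁ p₂ m₂ d₂ p₃ m₃ d₃ →
  p₁ * suc d₂ * suc d₃ + p₂ * suc d₁ * suc d₃ + m₃ * suc d₁ * suc d₂ ≡
  m₁ * suc d₂ * suc d₃ + m₂ * suc d₁ * suc d₃ + p₃ * suc d₁ * suc d₂ ⇔
  (fraction p₁ m₁ d₁ ℚᵘ.+ fraction p₂ m₂ d₂) ℚᵘ.≃ fraction p₃ m₃ d₃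
fraction-+ p₁ m₁ d₁ p₂ m₂ d₂ p₃ m₃ d₃ = ⇔-trans (≡-balance (begin
  ((ℤ.+ p₁ ℤ.+ ℤ.- (ℤ.+ m₁)) ℤ.* ℤ.+ D₂ ℤ.+ (ℤ.+ p₂ ℤ.+ ℤ.- (ℤ.+ m₂)) ℤ.* ℤ.+ D₁) ℤ.* ℤ.+ D₃
    ℤ.+ ℤ.- ((ℤ.+ p₃ ℤ.+ ℤ.- (ℤ.+ m₃)) ℤ.* ℤ.+ (D₁ * D₂))
    ≡⟨ cong (λ x → ((ℤ.+ p₁ ℤ.+ ℤ.- (ℤ.+ m₁)) ℤ.* ℤ.+ D₂ ℤ.+ (ℤ.+ p₂ ℤ.+ ℤ.- (ℤ.+ m₂)) ℤ.* ℤ.+ D₁) ℤ.* ℤ.+ D₃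
                   ℤ.+ ℤ.- ((ℤ.+ p₃ ℤ.+ ℤ.- (ℤ.+ m₃)) ℤ.* x)) (ℤₚ.pos-* D₁ D₂) ⟩
  ((ℤ.+ p₁ ℤ.+ ℤ.- (ℤ.+ m₁)) ℤ.* ℤ.+ D₂ ℤ.+ (ℤ.+ p₂ ℤ.+ ℤ.- (ℤ.+ m₂)) ℤ.* ℤ.+ D₁) ℤ.* ℤ.+ D₃
    ℤ.+ ℤ.- ((ℤ.+ p₃ ℤ.+ ℤ.- (ℤ.+ m₃)) ℤ.* (ℤ.+ D₁ ℤ.* ℤ.+ D₂))
    ≡⟨ ℤS.solve 9 (λ p₁ m₁ D₁ p₂ m₂ D₂ p₃ m₃ D₃ →
         ((p₁ :+ :- m₁) :* D₂ :+ (p₂ :+ :- m₂) :* D₁) :* D₃ :+ :- ((p₃ :+ :- m₃) :* (D₁ :* D₂)) :=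
         (p₁ :* D₂ :* D₃ :+ p₂ :* D₁ :* D₃ :+ m₃ :* D₁ :* D₂) :+
         :- (m₁ :* D₂ :* D₃ :+ m₂ :* D₁ :* D₃ :+ p₃ :* D₁ :* D₂))
       refl (ℤ.+ p₁) (ℤ.+ m₁) (ℤ.+ D₁) (ℤ.+ p₂) (ℤ.+ m₂) (ℤ.+ D₂) (ℤ.+ p₃) (ℤ.+ m₃) (ℤ.+ D₃) ⟩
  _ ≡⟨ cong₂ (λ x y → x ℤ.+ ℤ.- y)
         (cong₂ ℤ._+_ (cong₂ ℤ._+_ (pos-*₃ p₁ D₂ D₃) (pos-*₃ p₂ D₁ D₃)) (pos-*₃ m₃ D₁ D₂))
         (cong₂ ℤ._+_ (cong₂ ℤ._+_ (pos-*₃ m₁ D₂ D₃) (pos-*₃ m₂ D₁ D₃)) (pos-*₃ p₃ D₁ D₂)) ⟨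
  ℤ.+ (p₁ * D₂ * D₃ + p₂ * D₁ * D₃ + m₃ * D₁ * D₂) ℤ.+
    ℤ.- (ℤ.+ (m₁ * D₂ * D₃ + m₂ * D₁ * D₃ + p₃ * D₁ * D₂)) ∎)) ≃-cross
  where
  open ≡-Reasoning
  open ℤS using (_:+_; _:*_; :-_; _:=_)
  D₁ D₂ D₃ : ℕ
  D₁ = suc d₁
  D₂ = suc d₂
  D₃ = suc d₃

fraction-* : ∀ p₁ m₁ d₁ p₂ m₂ d₂ p₃ m₃ d₃ →
  p₁ * p₂ * suc d₃ + m₁ * m₂ * suc d₃ + m₃ * suc d₁ * suc d₂ ≡
  p₁ * m₂ * suc d₃ + m₁ * p₂ * suc d₃ + p₃ * suc d₁ * suc d₂ ⇔
  (fraction p₁ m₁ d₁ ℚᵘ.* fraction p₂ m₂ d₂) ℚᵘ.≃ fraction p₃ m₃ d₃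
fraction-* p₁ m₁ d₁ p₂ m₂ d₂ p₃ m₃ d₃ = ⇔-trans (≡-balance (begin
  ((ℤ.+ p₁ ℤ.+ ℤ.- (ℤ.+ m₁)) ℤ.* (ℤ.+ p₂ ℤ.+ ℤ.- (ℤ.+ m₂))) ℤ.* ℤ.+ D₃
    ℤ.+ ℤ.- ((ℤ.+ p₃ ℤ.+ ℤ.- (ℤ.+ m₃)) ℤ.* ℤ.+ (D₁ * D₂))
    ≡⟨ cong (λ x → ((ℤ.+ p₁ ℤ.+ ℤ.- (ℤ.+ m₁)) ℤ.* (ℤ.+ p₂ ℤ.+ ℤ.- (ℤ.+ m₂))) ℤ.* ℤ.+ D₃
                   ℤ.+ ℤ.- ((ℤ.+ p₃ ℤ.+ ℤ.- (ℤ.+ m₃)) ℤ.* x)) (ℤₚ.pos-* D₁ D₂) ⟩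
  ((ℤ.+ p₁ ℤ.+ ℤ.- (ℤ.+ m₁)) ℤ.* (ℤ.+ p₂ ℤ.+ ℤ.- (ℤ.+ m₂))) ℤ.* ℤ.+ D₃
    ℤ.+ ℤ.- ((ℤ.+ p₃ ℤ.+ ℤ.- (ℤ.+ m₃)) ℤ.* (ℤ.+ D₁ ℤ.* ℤ.+ D₂))
    ≡⟨ ℤS.solve 9 (λ p₁ m₁ D₁ p₂ m₂ D₂ p₃ m₃ D₃ →
         ((p₁ :+ :- m₁) :* (p₂ :+ :- m₂)) :* D₃ :+ :- ((p₃ :+ :- m₃) :* (D₁ :* D₂)) :=
         (p₁ :* p₂ :* D₃ :+ m₁ :* m₂ :* D₃ :+ m₃ :* D₁ :* D₂) :+
         :- (p₁ :* m₂ :* D₃ :+ m₁ :* p₂ :* D₃ :+ p₃ :* D₁ :* D₂))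
       refl (ℤ.+ p₁) (ℤ.+ m₁) (ℤ.+ D₁) (ℤ.+ p₂) (ℤ.+ m₂) (ℤ.+ D₂) (ℤ.+ p₃) (ℤ.+ m₃) (ℤ.+ D₃) ⟩
  _ ≡⟨ cong₂ (λ x y → x ℤ.+ ℤ.- y)
         (cong₂ ℤ._+_ (cong₂ ℤ._+_ (pos-*₃ p₁ p₂ D₃) (pos-*₃ m₁ m₂ D₃)) (pos-*₃ m₃ D₁ D₂))
         (cong₂ ℤ._+_ (cong₂ ℤ._+_ (pos-*₃ p₁ m₂ D₃) (pos-*₃ m₁ p₂ D₃)) (pos-*₃ p₃ D₁ D₂)) ⟨
  ℤ.+ (p₁ * p₂ * D₃ + m₁ * m₂ * D₃ + m₃ * D₁ * D₂) ℤ.+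
    ℤ.- (ℤ.+ (p₁ * m₂ * D₃ + m₁ * p₂ * D₃ + p₃ * D₁ * D₂)) ∎)) ≃-cross
  where
  open ≡-Reasoning
  open ℤS using (_:+_; _:*_; :-_; _:=_)
  D₁ D₂ D₃ : ℕ
  D₁ = suc d₁
  D₂ = suc d₂
  D₃ = suc d₃

plusᶜ : Computable f → Computable (λ ρ → π₁ (f ρ))
plusᶜ = π₁ᶜ

minusᶜ : Computable f → Computable (λ ρ → π₁ (π₂ (f ρ)))
minusᶜ c = π₁ᶜ (π₂ᶜ c)

denᶜ : Computable f → Computable (λ ρ → suc (π₂ (π₂ (f ρ))))
denᶜ c = sucᶜ (π₂ᶜ (π₂ᶜ c))

rational-≡ᶜ : Computable f → Computable g → Decidableᶜ (λ ρ → rational (f ρ) ≡ rational (g ρ))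
rational-≡ᶜ {f = f} {g} x y = mapᵈ
  (λ ρ → ⇔-trans (fraction-≃ (π₁ (f ρ)) (π₁ (π₂ (f ρ))) (π₂ (π₂ (f ρ))) (π₁ (g ρ)) (π₁ (π₂ (g ρ))) (π₂ (π₂ (g ρ))))
                 (⇔-sym fromℚᵘ-≡))
  (plusᶜ x *ᶜ denᶜ y +ᶜ minusᶜ y *ᶜ denᶜ x ≡ᶜ plusᶜ y *ᶜ denᶜ x +ᶜ minusᶜ x *ᶜ denᶜ y)

rational-+ᶜ : Computable f → Computable g → Computable h →
              Decidableᶜ (λ ρ → rational (h ρ) ≡ rational (f ρ) ℚ.+ rational (g ρ))
rational-+ᶜ {f = f} {g} {h} x y z = mapᵈ
  (λ ρ → ⇔-trans (fraction-+ (π₁ (f ρ)) (π₁ (π₂ (f ρ))) (π₂ (π₂ (f ρ))) (π₁ (g ρ)) (π₁ (π₂ (g ρ))) (π₂ (π₂ (g ρ)))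
                             (π₁ (h ρ)) (π₁ (π₂ (h ρ))) (π₂ (π₂ (h ρ))))
         (⇔-trans (⇔-sym fromℚᵘ-≡) (mk⇔ (λ e → sym (trans (fromℚᵘ-+ (unnormalised (f ρ)) (unnormalised (g ρ))) e))
                                          (λ e → trans (sym (fromℚᵘ-+ (unnormalised (f ρ)) (unnormalised (g ρ)))) (sym e)))))
  (plusᶜ x *ᶜ denᶜ y *ᶜ denᶜ z +ᶜ plusᶜ y *ᶜ denᶜ x *ᶜ denᶜ z +ᶜ minusᶜ z *ᶜ denᶜ x *ᶜ denᶜ y ≡ᶜ
   minusᶜ x *ᶜ denᶜ y *ᶜ denᶜ z +ᶜ minusᶜ y *ᶜ denᶜ x *ᶜ denᶜ z +ᶜ plusᶜ z *ᶜ denᶜ x *ᶜ denᶜ y)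

rational-*ᶜ : Computable f → Computable g → Computable h →
              Decidableᶜ (λ ρ → rational (h ρ) ≡ rational (f ρ) ℚ.* rational (g ρ))
rational-*ᶜ {f = f} {g} {h} x y z = mapᵈ
  (λ ρ → ⇔-trans (fraction-* (π₁ (f ρ)) (π₁ (π₂ (f ρ))) (π₂ (π₂ (f ρ))) (π₁ (g ρ)) (π₁ (π₂ (g ρ))) (π₂ (π₂ (g ρ)))
                             (π₁ (h ρ)) (π₁ (π₂ (h ρ))) (π₂ (π₂ (h ρ))))
         (⇔-trans (⇔-sym fromℚᵘ-≡) (mk⇔ (λ e → sym (trans (fromℚᵘ-* (unnormalised (f ρ)) (unnormalised (g ρ))) e))
                                          (λ e → trans (sym (fromℚᵘ-* (unnormalised (f ρ)) (unnormalised (g ρ)))) (sym e)))))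
  (plusᶜ x *ᶜ plusᶜ y *ᶜ denᶜ z +ᶜ minusᶜ x *ᶜ minusᶜ y *ᶜ denᶜ z +ᶜ minusᶜ z *ᶜ denᶜ x *ᶜ denᶜ y ≡ᶜ
   plusᶜ x *ᶜ minusᶜ y *ᶜ denᶜ z +ᶜ minusᶜ x *ᶜ plusᶜ y *ᶜ denᶜ z +ᶜ plusᶜ z *ᶜ denᶜ x *ᶜ denᶜ y)

-- Only the least code of each rational is used, so that codes form a copy of ℚ without a quotient.
Least : ℕ → Set
Least c = ∀ k → k < c → rational k ≢ rational c

abstract
  someCode : ∀ q → ∃[ c ] rational c ≡ q
  someCode q@(mkℚ (ℤ.+ k)    d _) = ⟪ k , ⟪ 0 , d ⟫ ⟫ , (begin
    rational ⟪ k , ⟪ 0 , d ⟫ ⟫ ≡⟨ cong₂ (λ x y → fromℚᵘ (fraction x (π₁ y) (π₂ y))) (π₁-⟪⟫ k ⟪ 0 , d ⟫) (π₂-⟪⟫ k ⟪ 0 , d ⟫) ⟩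
    fromℚᵘ (fraction k (π₁ ⟪ 0 , d ⟫) (π₂ ⟪ 0 , d ⟫)) ≡⟨ cong₂ (λ x y → fromℚᵘ (fraction k x y)) (π₁-⟪⟫ 0 d) (π₂-⟪⟫ 0 d) ⟩
    fromℚᵘ (fraction k 0 d) ≡⟨ cong (λ i → fromℚᵘ (mkℚᵘ i d)) (ℤₚ.+-identityʳ (ℤ.+ k)) ⟩
    fromℚᵘ (toℚᵘ q) ≡⟨ ℚₚ.fromℚᵘ-toℚᵘ q ⟩
    q ∎)
    where open ≡-Reasoning
  someCode q@(mkℚ (ℤ.-[1+ k ]) d _) = ⟪ 0 , ⟪ suc k , d ⟫ ⟫ , (begin
    rational ⟪ 0 , ⟪ suc k , d ⟫ ⟫ ≡⟨ cong₂ (λ x y → fromℚᵘ (fraction x (π₁ y) (π₂ y))) (π₁-⟪⟫ 0 ⟪ suc k , d ⟫) (π₂-⟪⟫ 0 ⟪ suc k , d ⟫) ⟩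
    fromℚᵘ (fraction 0 (π₁ ⟪ suc k , d ⟫) (π₂ ⟪ suc k , d ⟫)) ≡⟨ cong₂ (λ x y → fromℚᵘ (fraction 0 x y)) (π₁-⟪⟫ (suc k) d) (π₂-⟪⟫ (suc k) d) ⟩
    fromℚᵘ (fraction 0 (suc k) d) ≡⟨ ℚₚ.fromℚᵘ-toℚᵘ q ⟩
    q ∎)
    where open ≡-Reasoning

  leastCode : ∀ q → ∃[ c ] (rational c ≡ q × Least c)
  leastCode q = <-rec (λ c → rational c ≡ q → ∃[ c ] (rational c ≡ q × Least c)) step (proj₁ (someCode q)) (proj₂ (someCode q))
    where
    step : ∀ c → (∀ {k} → k < c → rational k ≡ q → ∃[ c ] (rational c ≡ q × Least c)) →
           rational c ≡ q → ∃[ c ] (rational c ≡ q × Least c)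
    step c rec e with anyUpTo? (λ k → rational k ℚₚ.≟ q) c
    ... | yes (k , k<c , e′) = rec k<c e′
    ... | no  none           = c , e , λ k k<c e′ → none (k , k<c , trans e′ e)

code : ℚ → ℕ
code q = proj₁ (leastCode q)

rational-code : ∀ q → rational (code q) ≡ q
rational-code q = proj₁ (proj₂ (leastCode q))

code-least : ∀ q → Least (code q)
code-least q = proj₂ (proj₂ (leastCode q))

code-rational : ∀ c → Least c → code (rational c) ≡ c
code-rational c least = ≤-antisym
  (≮⇒≥ (λ c< → code-least (rational c) c c< (sym (rational-code (rational c)))))
  (≮⇒≥ (λ <c → least _ <c (rational-code (rational c))))

rational-0 : rational 0 ≡ 0ℚ
rational-0 rewrite π₁-0 | π₂-0 | π₁-0 | π₂-0 = refl

code-0 : code 0ℚ ≡ 0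
code-0 = trans (cong code (sym rational-0)) (code-rational 0 (λ k ()))

Leastᶜ : Computable f → Decidableᶜ (λ ρ → Least (f ρ))
Leastᶜ cf = ∀<ᶜ cf (¬ᶜ (rational-≡ᶜ (var 0F) (weaken cf)))

-- Copies of structures inside ω

⇔-reflexive : ∀ {A : Set} (P : A → Set) {x y} → x ≡ y → P x ⇔ P y
⇔-reflexive P refl = ⇔-refl

map-inverse : ∀ {A B : Set} {n} {f : A → B} {g : B → A} → (∀ y → f (g y) ≡ y) →
              (ys : Vec B n) → Vec.map f (Vec.map g ys) ≡ ys
map-inverse {f = f} {g} inv ys = begin
  Vec.map f (Vec.map g ys) ≡⟨ Vecₚ.map-∘ f g ys ⟨
  Vec.map (f ∘ g) ys       ≡⟨ Vecₚ.map-cong inv ys ⟩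
  Vec.map id ys            ≡⟨ Vecₚ.map-id ys ⟩
  ys                       ∎
  where open ≡-Reasoning

map-injective : ∀ {A B : Set} {n} {f : A → B} → (∀ {x y} → f x ≡ f y → x ≡ y) →
                {xs ys : Vec A n} → Vec.map f xs ≡ Vec.map f ys → xs ≡ ys
map-injective inj {[]}     {[]}     e = refl
map-injective inj {x ∷ xs} {y ∷ ys} e =
  cong₂ _∷_ (inj (Vecₚ.∷-injectiveˡ e)) (map-injective inj (Vecₚ.∷-injectiveʳ e))

↔-to-injective : ∀ {A B : Set} (f : A ↔ B) {x y} → Inverse.to f x ≡ Inverse.to f y → x ≡ y
↔-to-injective f = Injection.injective (↔⇒↣ f)

module _ {L : Lang} where

  Universe : Structure L → Set
  Universe A = Σ ℕ (λ n → T (dom A n))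

  Universe-≡ : ∀ A {a b : Universe A} → proj₁ a ≡ proj₁ b → a ≡ b
  Universe-≡ A {n , s} {_ , t} refl = cong (n ,_) (T-irrelevant s t)

  ≅ᴬ-sym : {X Y : AStr L} → X ≅ᴬ Y → Y ≅ᴬ X
  ≅ᴬ-sym {X} {Y} (f , hom) = ↔-sym f , λ i v → ⇔-trans
    (⇔-reflexive (R Y i) (sym (map-inverse (λ y → Inverse.inverseˡ f refl) v)))
    (⇔-sym (hom i (Vec.map (Inverse.from f) v)))

  ≅ᴬ-trans : {X Y Z : AStr L} → X ≅ᴬ Y → Y ≅ᴬ Z → X ≅ᴬ Z
  ≅ᴬ-trans {X} {Y} {Z} (f , hom) (g , hom′) = ↔-trans f g , λ i v →
    ⇔-trans (hom i v) (⇔-trans (hom′ i (Vec.map (Inverse.to f) v))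
      (⇔-reflexive (R Z i) (sym (Vecₚ.map-∘ (Inverse.to g) (Inverse.to f) v))))

  -- An injection of X into ω with decidable image gives a copy of X with universe a subset of ω.
  record Numbering (X : AStr L) : Set where
    field
      number    : Carrier X → ℕ
      injective : ∀ {x y} → number x ≡ number y → x ≡ y
      image?    : ∀ n → Dec (∃ λ x → number x ≡ n)
      R?        : ∀ i v → Dec (R X i v)

  open Numbering public

  module _ {X : AStr L} (M : Numbering X) where

    images? : ∀ {n} (v : Vec ℕ n) → Dec (∃ λ xs → Vec.map (number M) xs ≡ v)
    images? []      = yes ([] , refl)
    images? (k ∷ v) with image? M k | images? v
    ... | yes (x , e) | yes (xs , es) = yes (x ∷ xs , cong₂ _∷_ e es)
    ... | no ¬x       | _             = no λ { (x ∷ xs , e) → ¬x (x , Vecₚ.∷-injectiveˡ e) }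
    ... | yes _       | no ¬xs        = no λ { (x ∷ xs , e) → ¬xs (xs , Vecₚ.∷-injectiveʳ e) }

    Holds : (i : Fin (size L)) → Vec ℕ (arity L i) → Set
    Holds i v = ∃ λ xs → Vec.map (number M) xs ≡ v × R X i xs

    holds? : ∀ i v → Dec (Holds i v)
    holds? i v with images? v
    ... | no ¬xs       = no λ (xs , e , _) → ¬xs (xs , e)
    ... | yes (xs , e) = map′ (λ r → xs , e , r)
      (λ (ys , e′ , r) → subst (R X i) (map-injective (injective M) (trans e′ (sym e))) r) (R? M i xs)

    copy : Structure L
    copy = record
      { dom     = λ n → isYes (image? M n)
      ; rel     = λ i v → isYes (holds? i v)
      ; rel-dom = λ i v t → in-dom v (map₂ proj₁ (toWitness {a? = holds? i v} t)) }
      where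
      in-dom : ∀ {n} (v : Vec ℕ n) → (∃ λ xs → Vec.map (number M) xs ≡ v) →
               VAll.All (λ a → T (isYes (image? M a))) v
      in-dom _ ([]     , refl) = []
      in-dom _ (x ∷ xs , refl) = fromWitness (x , refl) ∷ in-dom _ (xs , refl)

    copy-dom : ∀ n → T (dom copy n) ⇔ (∃ λ x → number M x ≡ n)
    copy-dom n = mk⇔ toWitness fromWitness

    copy-dom* : ∀ {n} (v : Vec ℕ n) → VAll.All (λ a → T (dom copy a)) v ⇔ (∃ λ xs → Vec.map (number M) xs ≡ v)
    copy-dom* v = mk⇔ (forth v) (back v)
      where
      forth : ∀ {n} (v : Vec ℕ n) → VAll.All (λ a → T (dom copy a)) v → ∃ λ xs → Vec.map (number M) xs ≡ v
      forth []      []       = [] , refl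
      forth (a ∷ v) (t ∷ ts) with to (copy-dom a) t | forth v ts
      ... | x , e | xs , es = x ∷ xs , cong₂ _∷_ e es
      back : ∀ {n} (v : Vec ℕ n) → (∃ λ xs → Vec.map (number M) xs ≡ v) → VAll.All (λ a → T (dom copy a)) v
      back _ ([]     , refl) = []
      back _ (x ∷ xs , refl) = from (copy-dom _) (x , refl) ∷ back _ (xs , refl)

    copy-rel : ∀ i xs → T (rel copy i (Vec.map (number M) xs)) ⇔ R X i xs
    copy-rel i xs = mk⇔
      (λ t → let ys , e , r = toWitness {a? = holds? i _} t in subst (R X i) (map-injective (injective M) e) r)
      (λ r → fromWitness (xs , refl , r))

    copy≅ : toAStr copy ≅ᴬ X
    copy≅ = mk↔ₛ′ decode encode decode-encode encode-decode , λ i v →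
      ⇔-trans (⇔-reflexive (λ w → T (rel copy i w)) (numbers v)) (copy-rel i (Vec.map decode v))
      where
      decode : Universe copy → Carrier X
      decode (n , t) = proj₁ (to (copy-dom n) t)
      number-decode : ∀ a → number M (decode a) ≡ proj₁ a
      number-decode (n , t) = proj₂ (to (copy-dom n) t)
      encode : Carrier X → Universe copy
      encode x = number M x , from (copy-dom _) (x , refl)
      decode-encode : ∀ x → decode (encode x) ≡ x
      decode-encode x = injective M (number-decode (encode x))
      encode-decode : ∀ a → encode (decode a) ≡ a
      encode-decode a = Universe-≡ copy (number-decode a)
      numbers : ∀ {n} (v : Vec (Universe copy) n) →
                Vec.map proj₁ v ≡ Vec.map (number M) (Vec.map decode v)
      numbers v = trans (Vecₚ.map-cong (λ a → sym (number-decode a)) v) (Vecₚ.map-∘ (number M) decode v)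

  isFalse : ∀ b → (¬ T b) ⇔ (b ≡ false)
  isFalse true  = mk⇔ (λ ¬t → ⊥-elim (¬t _)) λ ()
  isFalse false = mk⇔ (λ _ → refl) (λ _ ())

  D-copy-false : {X : AStr L} (M : Numbering X) (i : Fin (size L)) (v : Vec ℕ (arity L i)) →
                 D (copy M) (false , R[ i ] v) ⇔ (∃ λ xs → Vec.map (number M) xs ≡ v × ¬ R X i xs)
  D-copy-false {X} M i v = mk⇔
    (λ (ts , f) → let xs , e = to (copy-dom* M v) ts in
       xs , e , λ r → from (isFalse _) f (subst (λ v → T (rel (copy M) i v)) e (from (copy-rel M i xs) r)))
    (λ { (xs , refl , ¬r) → from (copy-dom* M v) (xs , refl) , to (isFalse _) (λ t → ¬r (to (copy-rel M i xs) t)) })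

  D-copy-true : {X : AStr L} (M : Numbering X) (i : Fin (size L)) (v : Vec ℕ (arity L i)) →
                D (copy M) (true , R[ i ] v) ⇔ (∃ λ xs → Vec.map (number M) xs ≡ v × R X i xs)
  D-copy-true M i v = mk⇔ toWitness fromWitness

  -- Transfer of literals along homomorphisms

  module _ {X Y : AStr L} (M : Numbering X) (N : Numbering Y) (f : Carrier X → Carrier Y)
           (preserves : ∀ i xs → R X i xs → R Y i (Vec.map f xs)) where

    Fixed : Carrier X → Set
    Fixed x = number N (f x) ≡ number M x

    -- This is what a literal asks of `f`: the elements it names keep their numbers, and `f`
    -- reflects the relation at its arguments, which lets negations survive. Equations compare
    -- constants, so for them the numbers suffice.
    Transferable : Literal L → Set
    Transferable (_ , eq a b)   = ∀ x → number M x ≡ a ⊎ number M x ≡ b → Fixed x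
    Transferable (_ , R[ i ] v) = ∀ xs → Vec.map (number M) xs ≡ v →
                                  VAll.All Fixed xs × (R Y i (Vec.map f xs) → R X i xs)

    fixed-numbers : ∀ {n} {xs : Vec (Carrier X) n} → VAll.All Fixed xs →
                    Vec.map (number N) (Vec.map f xs) ≡ Vec.map (number M) xs
    fixed-numbers []       = refl
    fixed-numbers (p ∷ ps) = cong₂ _∷_ p (fixed-numbers ps)

    transfer : ∀ φ → Transferable φ → D (copy M) φ → D (copy N) φ
    transfer (true  , eq a b) fix (t , refl) =
      let x , e = to (copy-dom M a) t in from (copy-dom N a) (f x , trans (fix x (inj₁ e)) e) , refl
    transfer (false , eq a b) fix (s , t , ne) =
      let x , d = to (copy-dom M a) s
          y , e = to (copy-dom M b) t
      in from (copy-dom N a) (f x , trans (fix x (inj₁ d)) d) , from (copy-dom N b) (f y , trans (fix y (inj₂ e)) e) , ne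
    transfer (true  , R[ i ] v) fix d = let xs , e , r = to (D-copy-true M i v) d
                  in from (D-copy-true N i v) (Vec.map f xs , trans (fixed-numbers (proj₁ (fix xs e))) e , preserves i xs r)
    transfer (false , R[ i ] v) fix d = let xs , e , ¬r = to (D-copy-false M i v) d
                  in from (D-copy-false N i v) (Vec.map f xs , trans (fixed-numbers (proj₁ (fix xs e))) e ,
                                          λ r → ¬r (proj₂ (fix xs e) r))

module _ {L : Lang} {Φ : List (Literal L) → Literal LO-Lang → Set} where

  -- The literal b = b expresses that b lies in the universe. Each of the k such literals is
  -- enumerated from a finite part of the diagram, and these parts are concatenated.
  support : ∀ A B → A ⟶[ Φ ] B → ∀ k (b : Fin k → ℕ) → (∀ i → T (dom B (b i))) →
            ∃[ α ] (LAll.All (D A) α × (∀ A′ B′ → A′ ⟶[ Φ ] B′ → LAll.All (D A′) α → ∀ i → T (dom B′ (b i))))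
  support A B A⟶B zero    b t = [] , [] , λ _ _ _ _ ()
  support A B A⟶B (suc k) b t
    with from (A⟶B (true , eq (b Fin.zero) (b Fin.zero))) (t Fin.zero , refl)
       | support A B A⟶B k (b ∘ Fin.suc) (t ∘ Fin.suc)
  ... | α , α⊆A , φ | β , β⊆A , rest = α List.++ β , LAllₚ.++⁺ α⊆A β⊆A , λ
    { A′ B′ A′⟶B′ αβ⊆A′ Fin.zero    → proj₁ (to (A′⟶B′ _) (α , LAllₚ.++⁻ˡ α αβ⊆A′ , φ))
    ; A′ B′ A′⟶B′ αβ⊆A′ (Fin.suc i) → rest A′ B′ A′⟶B′ (LAllₚ.++⁻ʳ α αβ⊆A′) i }

  -- The finitely many literals that put the elements of B into the image only use a finite part of A.
  image-size-≤ : ∀ {A B k l} → A ⟶[ Φ ] B → toAStr B ≅ᴬ FinOrd k →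
    (∀ α → LAll.All (D A) α → ∃₂ λ A′ B′ → LAll.All (D A′) α × A′ ⟶[ Φ ] B′ × toAStr B′ ≅ᴬ FinOrd l) →
    k ≤ l
  image-size-≤ {A} {B} {k} {l} A⟶B (f , _) realise
    with support A B A⟶B k (proj₁ ∘ Inverse.from f) (proj₂ ∘ Inverse.from f)
  ... | α , α⊆A , sup with realise α α⊆A
  ... | A′ , B′ , α⊆A′ , A′⟶B′ , (g , _) =
    injective⇒≤ {f = λ i → Inverse.to g (_ , sup A′ B′ A′⟶B′ α⊆A′ i)} λ e →
      ↔-to-injective (↔-sym f) (Universe-≡ B (cong proj₁ (↔-to-injective g e)))

-- Invariance of dimension

open Sums (CommutativeRing.semiring ℚₚ.+-*-commutativeRing)
  using (sum; sum-syntax; sum-cong-≗; sum-replicate-zero; ∑-distrib-+; *-distribʳ-sum)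

sum-zero : ∀ {n} (f : Fin n → ℚ) → (∀ i → f i ≡ 0ℚ) → sum f ≡ 0ℚ
sum-zero {n} f f≡0 = trans (sum-cong-≗ f≡0) (sum-replicate-zero n)

Dependence : ∀ {m n} → (Fin m → Fin n → ℚ) → Set
Dependence {m} {n} v = Σ[ s ∈ (Fin m → ℚ) ] ((∃[ i ] s i ≢ 0ℚ) × (∀ j → ∑[ i < m ] (s i ℚ.* v i j) ≡ 0ℚ))

-- Gaussian elimination of one coordinate by the first vector.
dependence : ∀ {m n} → n < m → (v : Fin m → Fin n → ℚ) → Dependence v
dependence {suc m} {zero}  _         v = (λ _ → 1ℚ) , (0F , ℚₚ.1≢0) , λ ()
dependence {suc m} {suc n} (s≤s n<m) v with any? (λ j → ¬? (v 0F j ℚₚ.≟ 0ℚ))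
-- The first vector is zero here, hence dependent by itself.
... | no v₀≡0 = s , (0F , ℚₚ.1≢0) , λ j → cong₂ ℚ._+_
    (trans (ℚₚ.*-identityˡ (v 0F j)) (decidable-stable (v 0F j ℚₚ.≟ 0ℚ) (λ ne → v₀≡0 (j , ne))))
    (sum-zero (λ i → 0ℚ ℚ.* v (Fin.suc i) j) (λ i → ℚₚ.*-zeroˡ (v (Fin.suc i) j)))
  where
  s : Fin (suc m) → ℚ
  s 0F          = 1ℚ
  s (Fin.suc _) = 0ℚ
... | yes (j₀ , pivot≢0) = extend (dependence n<m (λ i k → w i (punchIn j₀ k)))
  where
  instance
    _ : ℚ.NonZero (v 0F j₀)
    _ = ℚ.≢-nonZero pivot≢0
  r : Fin m → ℚ
  r i = v (Fin.suc i) j₀ ℚ.* ℚ.1/ v 0F j₀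
  -- After the pivot coordinate is cleared and deleted, there are m vectors with n coordinates, and
  -- the induction hypothesis applies.
  w : Fin m → Fin (suc n) → ℚ
  w i j = v (Fin.suc i) j ℚ.+ ℚ.- (r i ℚ.* v 0F j)
  w-pivot : ∀ i → w i j₀ ≡ 0ℚ
  w-pivot i = begin
    x ℚ.+ ℚ.- (x ℚ.* ℚ.1/ p ℚ.* p) ≡⟨ cong (λ y → x ℚ.+ ℚ.- y) (ℚₚ.*-assoc x (ℚ.1/ p) p) ⟩
    x ℚ.+ ℚ.- (x ℚ.* (ℚ.1/ p ℚ.* p)) ≡⟨ cong (λ y → x ℚ.+ ℚ.- (x ℚ.* y)) (ℚₚ.*-inverseˡ p) ⟩
    x ℚ.+ ℚ.- (x ℚ.* 1ℚ) ≡⟨ cong (λ y → x ℚ.+ ℚ.- y) (ℚₚ.*-identityʳ x) ⟩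
    x ℚ.+ ℚ.- x ≡⟨ ℚₚ.+-inverseʳ x ⟩
    0ℚ ∎
    where
    open ≡-Reasoning
    x = v (Fin.suc i) j₀
    p = v 0F j₀
  extend : Dependence (λ i k → w i (punchIn j₀ k)) → Dependence v
  extend (s , (i , sᵢ≢0) , e) = s⁺ , (Fin.suc i , sᵢ≢0) , λ j → begin
    ℚ.- (∑[ i < m ] (s i ℚ.* r i)) ℚ.* v 0F j ℚ.+ ∑[ i < m ] (s i ℚ.* v (Fin.suc i) j)
      ≡⟨ cong (ℚ.- (∑[ i < m ] (s i ℚ.* r i)) ℚ.* v 0F j ℚ.+_) (begin
        ∑[ i < m ] (s i ℚ.* v (Fin.suc i) j)
          ≡⟨ sum-cong-≗ (λ i → ℚS.solve 4 (λ s v r v₀ → s :* v := (s :* r) :* v₀ :+ s :* (v :+ :- (r :* v₀)))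
                                     refl (s i) (v (Fin.suc i) j) (r i) (v 0F j)) ⟩
        ∑[ i < m ] (s i ℚ.* r i ℚ.* v 0F j ℚ.+ s i ℚ.* w i j)
          ≡⟨ ∑-distrib-+ (λ i → s i ℚ.* r i ℚ.* v 0F j) (λ i → s i ℚ.* w i j) ⟩
        ∑[ i < m ] (s i ℚ.* r i ℚ.* v 0F j) ℚ.+ ∑[ i < m ] (s i ℚ.* w i j)
          ≡⟨ cong₂ ℚ._+_ (sym (*-distribʳ-sum (v 0F j) (λ i → s i ℚ.* r i))) (vanish j) ⟩
        (∑[ i < m ] (s i ℚ.* r i)) ℚ.* v 0F j ℚ.+ 0ℚ ∎) ⟩
    ℚ.- (∑[ i < m ] (s i ℚ.* r i)) ℚ.* v 0F j ℚ.+ ((∑[ i < m ] (s i ℚ.* r i)) ℚ.* v 0F j ℚ.+ 0ℚ)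
      ≡⟨ ℚS.solve 2 (λ a x → (:- a) :* x :+ (a :* x :+ con 0ℚ) := con 0ℚ) refl (∑[ i < m ] (s i ℚ.* r i)) (v 0F j) ⟩
    0ℚ ∎
    where
    open ≡-Reasoning
    open ℚS using (_:+_; _:*_; :-_; _:=_; con)
    s⁺ : Fin (suc m) → ℚ
    -- Each `w i` contains minus `r i` times the first vector; this coefficient collects those
    -- multiples.
    s⁺ 0F          = ℚ.- (∑[ i < m ] (s i ℚ.* r i))
    s⁺ (Fin.suc i) = s i
    vanish : ∀ j → ∑[ i < m ] (s i ℚ.* w i j) ≡ 0ℚ
    vanish j with j₀ Finₚ.≟ j
    ... | yes refl = sum-zero (λ i → s i ℚ.* w i j₀) (λ i → trans (cong (s i ℚ.*_) (w-pivot i)) (ℚₚ.*-zeroʳ (s i)))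
    ... | no j₀≢j  = subst (λ j → ∑[ i < m ] (s i ℚ.* w i j) ≡ 0ℚ) (punchIn-punchOut j₀≢j) (e (punchOut j₀≢j))

lookup-ext : ∀ {A : Set} {n} {u v : Vec A n} → (∀ j → lookup u j ≡ lookup v j) → u ≡ v
lookup-ext {u = u} {v} e =
  trans (sym (Vecₚ.tabulate∘lookup u)) (trans (Vecₚ.tabulate-cong e) (Vecₚ.tabulate∘lookup v))

unit : ∀ {m} → Fin m → Vec ℚ m
unit 0F          = 1ℚ ∷ Vec.replicate _ 0ℚ
unit (Fin.suc i) = 0ℚ ∷ unit i

-- `σ` is the action of an isomorphism on the sort of scalars. With `σ` the identity these are the
-- linear maps, used for paddings and projections.
record Semilinear (σ : ℚ → ℚ) {m n} (φ : Vec ℚ m → Vec ℚ n) : Set where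
  field
    σ-0        : σ 0ℚ ≡ 0ℚ
    additive   : ∀ u v → φ (Vec.zipWith ℚ._+_ u v) ≡ Vec.zipWith ℚ._+_ (φ u) (φ v)
    homogeneous : ∀ a v → φ (Vec.map (a ℚ.*_) v) ≡ Vec.map (σ a ℚ.*_) (φ v)

open Semilinear

map-0* : ∀ {n} (u : Vec ℚ n) → Vec.map (0ℚ ℚ.*_) u ≡ Vec.replicate n 0ℚ
map-0* []      = refl
map-0* (x ∷ u) = cong₂ _∷_ (ℚₚ.*-zeroˡ x) (map-0* u)

map-*0 : ∀ a n → Vec.map (a ℚ.*_) (Vec.replicate n 0ℚ) ≡ Vec.replicate n 0ℚ
map-*0 a zero    = refl
map-*0 a (suc n) = cong₂ _∷_ (ℚₚ.*-zeroʳ a) (map-*0 a n)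

zip-0+ : ∀ {n} (u : Vec ℚ n) → Vec.zipWith ℚ._+_ (Vec.replicate n 0ℚ) u ≡ u
zip-0+ []      = refl
zip-0+ (x ∷ u) = cong₂ _∷_ (ℚₚ.+-identityˡ x) (zip-0+ u)

-- Split x ∷ u into x times the first unit vector plus 0 ∷ u. On vectors with first coordinate 0 the
-- map is again semilinear, in one dimension less.
semilinear-combination : ∀ {σ m n} {φ : Vec ℚ m → Vec ℚ n} → Semilinear σ φ → ∀ u j →
  lookup (φ u) j ≡ ∑[ i < m ] (σ (lookup u i) ℚ.* lookup (φ (unit i)) j)
-- The empty vector is 0 times itself, so its image is the zero vector.
semilinear-combination {σ} {zero} {n} {φ} lin [] j = begin
  lookup (φ []) j ≡⟨ cong (λ w → lookup w j) (homogeneous lin 0ℚ []) ⟩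
  lookup (Vec.map (σ 0ℚ ℚ.*_) (φ [])) j ≡⟨ cong (λ a → lookup (Vec.map (a ℚ.*_) (φ [])) j) (σ-0 lin) ⟩
  lookup (Vec.map (0ℚ ℚ.*_) (φ [])) j ≡⟨ cong (λ w → lookup w j) (map-0* (φ [])) ⟩
  lookup (Vec.replicate n 0ℚ) j ≡⟨ Vecₚ.lookup-replicate j 0ℚ ⟩
  0ℚ ∎
  where open ≡-Reasoning
semilinear-combination {σ} {suc m} {n} {φ} lin (x ∷ u) j = begin
  lookup (φ (x ∷ u)) j
    ≡⟨ cong (λ w → lookup (φ w) j) split ⟨
  lookup (φ (Vec.zipWith ℚ._+_ (Vec.map (x ℚ.*_) (unit 0F)) (0ℚ ∷ u))) j
    ≡⟨ cong (λ w → lookup w j) (additive lin (Vec.map (x ℚ.*_) (unit 0F)) (0ℚ ∷ u)) ⟩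
  lookup (Vec.zipWith ℚ._+_ (φ (Vec.map (x ℚ.*_) (unit 0F))) (φ (0ℚ ∷ u))) j
    ≡⟨ Vecₚ.lookup-zipWith ℚ._+_ j (φ (Vec.map (x ℚ.*_) (unit 0F))) (φ (0ℚ ∷ u)) ⟩
  lookup (φ (Vec.map (x ℚ.*_) (unit 0F))) j ℚ.+ lookup (φ (0ℚ ∷ u)) j
    ≡⟨ cong₂ ℚ._+_
         (trans (cong (λ w → lookup w j) (homogeneous lin x (unit 0F))) (Vecₚ.lookup-map j (σ x ℚ.*_) (φ (unit 0F))))
         (semilinear-combination lin′ u j) ⟩
  σ x ℚ.* lookup (φ (unit 0F)) j ℚ.+ ∑[ i < m ] (σ (lookup u i) ℚ.* lookup (φ (0ℚ ∷ unit i)) j) ∎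
  where
  open ≡-Reasoning
  split : Vec.zipWith ℚ._+_ (Vec.map (x ℚ.*_) (unit 0F)) (0ℚ ∷ u) ≡ x ∷ u
  split = cong₂ _∷_ (trans (ℚₚ.+-identityʳ (x ℚ.* 1ℚ)) (ℚₚ.*-identityʳ x))
                    (trans (cong (λ w → Vec.zipWith ℚ._+_ w u) (map-*0 x m)) (zip-0+ u))
  lin′ : Semilinear σ (λ u → φ (0ℚ ∷ u))
  lin′ = record
    { σ-0        = σ-0 lin
    ; additive   = λ u v → additive lin (0ℚ ∷ u) (0ℚ ∷ v)
    ; homogeneous = λ a v → trans (cong (λ z → φ (z ∷ Vec.map (a ℚ.*_) v)) (sym (ℚₚ.*-zeroʳ a))) (homogeneous lin a (0ℚ ∷ v)) }

module Components {m n} (F : QVS m ≅ᴬ QVS n) where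

  F→ : ℚ ⊎ Vec ℚ m → ℚ ⊎ Vec ℚ n
  F→ = Inverse.to (proj₁ F)

  F-injective : ∀ {x y} → F→ x ≡ F→ y → x ≡ y
  F-injective = ↔-to-injective (proj₁ F)

  scalar : ∀ a → ∃[ b ] (F→ (inj₁ a) ≡ inj₁ b)
  scalar a = to (proj₂ F 1F (inj₁ a ∷ [])) (a , refl)

  vector : ∀ u → ∃[ v ] (F→ (inj₂ u) ≡ inj₂ v)
  vector u = to (proj₂ F 0F (inj₂ u ∷ [])) (u , refl)

  σ : ℚ → ℚ
  σ a = proj₁ (scalar a)

  φ : Vec ℚ m → Vec ℚ n
  φ u = proj₁ (vector u)

  semilinear : Semilinear σ φ
  semilinear = record
    { σ-0 = Sumₚ.inj₁-injective (trans (sym (proj₂ (scalar 0ℚ))) (to (proj₂ F 2F (inj₁ 0ℚ ∷ [])) refl))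
    ; additive = λ u v →
        let u′ , v′ , eu , ev , e = to (proj₂ F 7F (inj₂ u ∷ inj₂ v ∷ inj₂ (Vec.zipWith ℚ._+_ u v) ∷ [])) (u , v , refl , refl , refl)
        in trans (vec e) (sym (cong₂ (Vec.zipWith ℚ._+_) (vec eu) (vec ev)))
    ; homogeneous = λ a v →
        let a′ , v′ , ea , ev , e = to (proj₂ F 8F (inj₁ a ∷ inj₂ v ∷ inj₂ (Vec.map (a ℚ.*_) v) ∷ [])) (a , v , refl , refl , refl)
        in trans (vec e) (sym (cong₂ (λ a v → Vec.map (a ℚ.*_) v) (Sumₚ.inj₁-injective (trans (sym (proj₂ (scalar a))) ea)) (vec ev))) }
    where
    vec : ∀ {u v} → F→ (inj₂ u) ≡ inj₂ v → φ u ≡ v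
    vec {u} e = Sumₚ.inj₂-injective (trans (sym (proj₂ (vector u))) e)

  φ-injective : ∀ {u v} → φ u ≡ φ v → u ≡ v
  φ-injective {u} {v} e = Sumₚ.inj₂-injective (F-injective (trans (proj₂ (vector u)) (trans (cong inj₂ e) (sym (proj₂ (vector v))))))

-- If n < m, the images of the m unit vectors are dependent. The inverse isomorphism shows that `σ`
-- is onto, so the coefficients can be pulled back to the coordinates of a vector u with the same
-- image as 0; injectivity then contradicts the nonzero coefficient.
QVS-dimension-≤ : ∀ {m n} → QVS m ≅ᴬ QVS n → m ≤ n
QVS-dimension-≤ {m} {n} F = ≮⇒≥ λ n<m → independent (dependence n<m (λ i j → lookup (φ (unit i)) j))
  where
  open Components F
  module G = Components (≅ᴬ-sym F)
  σ-G : ∀ a → σ (G.σ a) ≡ a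
  σ-G a = Sumₚ.inj₁-injective (begin
    inj₁ (σ (G.σ a))         ≡⟨ proj₂ (scalar (G.σ a)) ⟨
    F→ (inj₁ (G.σ a))        ≡⟨ cong F→ (proj₂ (G.scalar a)) ⟨
    F→ (G.F→ (inj₁ a))       ≡⟨ Inverse.inverseˡ (proj₁ F) refl ⟩
    inj₁ a                   ∎)
    where open ≡-Reasoning
  independent : ¬ Dependence (λ i j → lookup (φ (unit i)) j)
  independent (s , (i , sᵢ≢0) , e) = sᵢ≢0 (begin
    s i                      ≡⟨ σ-G (s i) ⟨
    σ (G.σ (s i))            ≡⟨ cong σ (Vecₚ.lookup∘tabulate (G.σ ∘ s) i) ⟨
    σ (lookup u i)           ≡⟨ cong (λ w → σ (lookup w i)) (φ-injective φu≡φ0) ⟩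
    σ (lookup 0s i)          ≡⟨ cong σ (Vecₚ.lookup-replicate i 0ℚ) ⟩
    σ 0ℚ                     ≡⟨ σ-0 semilinear ⟩
    0ℚ                       ∎)
    where
    open ≡-Reasoning
    u 0s : Vec ℚ m
    u = tabulate (G.σ ∘ s)
    0s = Vec.replicate m 0ℚ
    φu≡φ0 : φ u ≡ φ 0s
    φu≡φ0 = lookup-ext λ j → begin
      lookup (φ u) j
        ≡⟨ semilinear-combination semilinear u j ⟩
      ∑[ i < m ] (σ (lookup u i) ℚ.* lookup (φ (unit i)) j)
        ≡⟨ sum-cong-≗ (λ i → cong (ℚ._* lookup (φ (unit i)) j)
             (trans (cong σ (Vecₚ.lookup∘tabulate (G.σ ∘ s) i)) (σ-G (s i)))) ⟩
      ∑[ i < m ] (s i ℚ.* lookup (φ (unit i)) j)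
        ≡⟨ e j ⟩
      0ℚ
        ≡⟨ sum-zero (λ i → σ (lookup 0s i) ℚ.* lookup (φ (unit i)) j) (λ i →
             trans (cong (ℚ._* lookup (φ (unit i)) j) (trans (cong σ (Vecₚ.lookup-replicate i 0ℚ)) (σ-0 semilinear)))
                   (ℚₚ.*-zeroˡ (lookup (φ (unit i)) j))) ⟨
      ∑[ i < m ] (σ (lookup 0s i) ℚ.* lookup (φ (unit i)) j)
        ≡⟨ semilinear-combination semilinear 0s j ⟨
      lookup (φ 0s) j ∎

QVS-dimension : ∀ {m n} → QVS m ≅ᴬ QVS n → m ≡ n
QVS-dimension F = ≤-antisym (QVS-dimension-≤ F) (QVS-dimension-≤ (≅ᴬ-sym F))

-- Copies of ℚᵏ with uniformly computable diagrams

∀<⇔∀Fin : ∀ {k} {P : ℕ → Set} → (∀ i → i < k → P i) ⇔ (∀ (i : Fin k) → P (toℕ i))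
∀<⇔∀Fin {P = P} = mk⇔ (λ p i → p (toℕ i) (toℕ<n i)) (λ p i i<k → subst P (toℕ-fromℕ< i<k) (p (fromℕ< i<k)))

⋁ᶜ : ∀ {n m} {P : Fin m → Vec ℕ n → Set} → (∀ i → Decidableᶜ (P i)) → Decidableᶜ (λ ρ → ∃ λ i → P i ρ)
⋁ᶜ {m = zero}  d = mapᵈ (λ ρ → mk⇔ (λ ()) (λ ())) (lit 1 ≡ᶜ lit 0)
⋁ᶜ {m = suc m} d = mapᵈ (λ ρ → mk⇔ [ (λ p → 0F , p) , (λ (i , p) → Fin.suc i , p) ]
                                   (λ { (0F , p) → inj₁ p ; (Fin.suc i , p) → inj₂ (i , p) }))
                        (d 0F ∨ᶜ ⋁ᶜ (λ i → d (Fin.suc i)))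

coordinates : ∀ k → ℕ → Vec ℚ k
coordinates k v = tabulate (λ i → rational (nth v (toℕ i)))

-- The dimension is deliberately not recorded. As `code 0ℚ` is 0 and ⟪ 0 , 0 ⟫ is 0, a vector padded
-- with zeros keeps its code.
codeVector : ∀ {k} → Vec ℚ k → ℕ
codeVector []      = 0
codeVector (q ∷ u) = ⟪ code q , codeVector u ⟫

nthTail-code : ∀ {k} (u : Vec ℚ k) → nthTail (codeVector u) k ≡ 0
nthTail-code []                  = refl
nthTail-code {k = suc k} (q ∷ u) = trans (nthTail-suc (codeVector (q ∷ u)) k)
  (trans (cong (λ v → nthTail v k) (π₂-⟪⟫ (code q) (codeVector u))) (nthTail-code u))

nth-suc : ∀ v i → nth v (suc i) ≡ nth (π₂ v) i
nth-suc v i = cong π₁ (nthTail-suc v i)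

nth-code : ∀ {k} (u : Vec ℚ k) i → nth (codeVector u) (toℕ i) ≡ code (lookup u i)
nth-code (q ∷ u) 0F          = π₁-⟪⟫ (code q) (codeVector u)
nth-code (q ∷ u) (Fin.suc i) = trans (nth-suc (codeVector (q ∷ u)) (toℕ i))
  (trans (cong (λ v → nth v (toℕ i)) (π₂-⟪⟫ (code q) (codeVector u))) (nth-code u i))

coordinates-code : ∀ {k} (u : Vec ℚ k) → coordinates k (codeVector u) ≡ u
coordinates-code u = lookup-ext λ i → trans (Vecₚ.lookup∘tabulate _ i)
  (trans (cong rational (nth-code u i)) (rational-code (lookup u i)))

code-coordinates : ∀ k v → (∀ i → i < k → Least (nth v i)) → nthTail v k ≡ 0 → codeVector (coordinates k v) ≡ v
code-coordinates zero    v least e = sym e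
code-coordinates (suc k) v least e = begin
  ⟪ code (rational (π₁ v)) , codeVector {k} (tabulate (λ i → rational (nth v (suc (toℕ i))))) ⟫
    ≡⟨ cong₂ (λ a u → ⟪ a , codeVector {k} u ⟫) (code-rational (π₁ v) (least 0 z<s))
             (Vecₚ.tabulate-cong {n = k} (λ i → cong rational (nth-suc v (toℕ i)))) ⟩
  ⟪ π₁ v , codeVector (coordinates k (π₂ v)) ⟫
    ≡⟨ cong ⟪ π₁ v ,_⟫ (code-coordinates k (π₂ v) (λ i i<k → subst Least (nth-suc v i) (least (suc i) (s≤s i<k)))
                                           (trans (sym (nthTail-suc v k)) e)) ⟩
  ⟪ π₁ v , π₂ v ⟫
    ≡⟨ ⟪π₁,π₂⟫ v ⟩
  v ∎
  where open ≡-Reasoning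

numberOf : ∀ k → ℚ ⊎ Vec ℚ k → ℕ
numberOf k (inj₁ a) = ⟪ 0 , code a ⟫
numberOf k (inj₂ u) = ⟪ 1 , codeVector u ⟫

-- Every number is decoded to something, any tag other than 0 being read as that of a vector. So the
-- tests of relations only compare tags with 0, and `Valid` is checked separately.
decode : ∀ k → ℕ → ℚ ⊎ Vec ℚ k
decode k m with π₁ m ≟ 0
... | yes _ = inj₁ (rational (π₂ m))
... | no  _ = inj₂ (coordinates k (π₂ m))

decode-scalar : ∀ k m → π₁ m ≡ 0 → decode k m ≡ inj₁ (rational (π₂ m))
decode-scalar k m e with π₁ m ≟ 0
... | yes _ = refl
... | no ne = ⊥-elim (ne e)

decode-vector : ∀ k m → π₁ m ≢ 0 → decode k m ≡ inj₂ (coordinates k (π₂ m))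
decode-vector k m ne with π₁ m ≟ 0
... | yes e = ⊥-elim (ne e)
... | no  _ = refl

decode-numberOf : ∀ k x → decode k (numberOf k x) ≡ x
decode-numberOf k (inj₁ a) = trans (decode-scalar k _ (π₁-⟪⟫ 0 (code a)))
  (cong inj₁ (trans (cong rational (π₂-⟪⟫ 0 (code a))) (rational-code a)))
decode-numberOf k (inj₂ u) = trans (decode-vector k _ (λ e → 1+n≢0 (trans (sym (π₁-⟪⟫ 1 (codeVector u))) e)))
  (cong inj₂ (trans (cong (coordinates k) (π₂-⟪⟫ 1 (codeVector u))) (coordinates-code u)))

-- An arithmetical description of the range of `numberOf k`; the vanishing tail excludes nonzero
-- coordinates beyond the k-th.
Valid : ℕ → ℕ → Set
Valid k m = (π₁ m ≡ 0 × Least (π₂ m)) ⊎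
            (π₁ m ≡ 1 × (∀ i → i < k → Least (nth (π₂ m) i)) × nthTail (π₂ m) k ≡ 0)

numberOf-valid : ∀ k x → Valid k (numberOf k x)
numberOf-valid k (inj₁ a) = inj₁ (π₁-⟪⟫ 0 (code a) , subst Least (sym (π₂-⟪⟫ 0 (code a))) (code-least a))
numberOf-valid k (inj₂ u) = inj₂ (π₁-⟪⟫ 1 (codeVector u) ,
  subst (λ v → (∀ i → i < k → Least (nth v i)) × nthTail v k ≡ 0) (sym (π₂-⟪⟫ 1 (codeVector u)))
    (from ∀<⇔∀Fin (λ i → subst Least (sym (nth-code u i)) (code-least (lookup u i))) , nthTail-code u))

numberOf-decode : ∀ k m → Valid k m → numberOf k (decode k m) ≡ m
numberOf-decode k m (inj₁ (e , least)) = trans (cong (numberOf k) (decode-scalar k m e))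
  (trans (cong₂ ⟪_,_⟫ (sym e) (code-rational (π₂ m) least)) (⟪π₁,π₂⟫ m))
numberOf-decode k m (inj₂ (e , least , end)) =
  trans (cong (numberOf k) (decode-vector k m (λ e′ → 1+n≢0 (trans (sym e) e′))))
  (trans (cong₂ ⟪_,_⟫ (sym e) (code-coordinates k (π₂ m) least end)) (⟪π₁,π₂⟫ m))

QVS-R? : ∀ k i v → Dec (QVS-R k i v)
QVS-R? k 0F (inj₁ a ∷ []) = no λ ()
QVS-R? k 0F (inj₂ u ∷ []) = yes (u , refl)
QVS-R? k 1F (inj₁ a ∷ []) = yes (a , refl)
QVS-R? k 1F (inj₂ u ∷ []) = no λ ()
QVS-R? k 2F (x ∷ []) = Sumₚ.≡-dec ℚₚ._≟_ (Vecₚ.≡-dec ℚₚ._≟_) x _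
QVS-R? k 3F (x ∷ []) = Sumₚ.≡-dec ℚₚ._≟_ (Vecₚ.≡-dec ℚₚ._≟_) x _
QVS-R? k 4F (inj₁ a ∷ inj₁ b ∷ z ∷ []) with Sumₚ.≡-dec ℚₚ._≟_ (Vecₚ.≡-dec ℚₚ._≟_) z (inj₁ (a ℚ.+ b))
... | yes e = yes (a , b , refl , refl , e)
... | no ne = no λ { (_ , _ , refl , refl , e) → ne e }
QVS-R? k 4F (inj₁ a ∷ inj₂ v ∷ z ∷ []) = no λ { (_ , _ , _ , () , _) }
QVS-R? k 4F (inj₂ u ∷ y ∷ z ∷ []) = no λ { (_ , _ , () , _) }
QVS-R? k 5F (inj₁ a ∷ inj₁ b ∷ z ∷ []) with Sumₚ.≡-dec ℚₚ._≟_ (Vecₚ.≡-dec ℚₚ._≟_) z (inj₁ (a ℚ.* b))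
... | yes e = yes (a , b , refl , refl , e)
... | no ne = no λ { (_ , _ , refl , refl , e) → ne e }
QVS-R? k 5F (inj₁ a ∷ inj₂ v ∷ z ∷ []) = no λ { (_ , _ , _ , () , _) }
QVS-R? k 5F (inj₂ u ∷ y ∷ z ∷ []) = no λ { (_ , _ , () , _) }
QVS-R? k 6F (x ∷ []) = Sumₚ.≡-dec ℚₚ._≟_ (Vecₚ.≡-dec ℚₚ._≟_) x _
QVS-R? k 7F (inj₂ u ∷ inj₂ v ∷ z ∷ []) with Sumₚ.≡-dec ℚₚ._≟_ (Vecₚ.≡-dec ℚₚ._≟_) z (inj₂ (Vec.zipWith ℚ._+_ u v))
... | yes e = yes (u , v , refl , refl , e)
... | no ne = no λ { (_ , _ , refl , refl , e) → ne e }
QVS-R? k 7F (inj₂ u ∷ inj₁ b ∷ z ∷ []) = no λ { (_ , _ , _ , () , _) }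
QVS-R? k 7F (inj₁ a ∷ y ∷ z ∷ []) = no λ { (_ , _ , () , _) }
QVS-R? k 8F (inj₁ a ∷ inj₂ v ∷ z ∷ []) with Sumₚ.≡-dec ℚₚ._≟_ (Vecₚ.≡-dec ℚₚ._≟_) z (inj₂ (Vec.map (a ℚ.*_) v))
... | yes e = yes (a , v , refl , refl , e)
... | no ne = no λ { (_ , _ , refl , refl , e) → ne e }
QVS-R? k 8F (inj₁ a ∷ inj₁ b ∷ z ∷ []) = no λ { (_ , _ , _ , () , _) }
QVS-R? k 8F (inj₂ u ∷ y ∷ z ∷ []) = no λ { (_ , _ , () , _) }

numbering : ∀ k → Numbering (QVS k)
numbering k = record
  { number    = numberOf k
  ; injective = λ {x} {y} e → trans (sym (decode-numberOf k x)) (trans (cong (decode k) e) (decode-numberOf k y))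
  ; image?    = image
  ; R?        = QVS-R? k }
  where
  image : ∀ m → Dec (∃ λ x → numberOf k x ≡ m)
  image m with numberOf k (decode k m) ≟ m
  ... | yes e = yes (decode k m , e)
  ... | no ne = no λ { (x , refl) → ne (cong (numberOf k) (decode-numberOf k x)) }

space : ℕ → Structure VS-Lang
space k = copy (numbering k)

space-dom : ∀ k m → T (dom (space k) m) ⇔ Valid k m
space-dom k m = ⇔-trans (copy-dom (numbering k) m) (mk⇔
  (λ { (x , refl) → numberOf-valid k x })
  (λ v → decode k m , numberOf-decode k m v))

Leastᶜ-nth : Computable f → Computable g → Decidableᶜ (λ ρ → ∀ i → i < f ρ → Least (nth (g ρ) i))
Leastᶜ-nth cf cg = ∀<ᶜ cf (Leastᶜ (nthᶜ (weaken cg) (var 0F)))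

Validᶜ : Computable f → Computable g → Decidableᶜ (λ ρ → Valid (f ρ) (g ρ))
Validᶜ k m = ((π₁ᶜ m ≡ᶜ lit 0) ∧ᶜ Leastᶜ (π₂ᶜ m)) ∨ᶜ
             ((π₁ᶜ m ≡ᶜ lit 1) ∧ᶜ Leastᶜ-nth k (π₂ᶜ m) ∧ᶜ (nthTailᶜ (π₂ᶜ m) k ≡ᶜ lit 0))

module _ (k : ℕ) where

  -- The relations of the standard model quantify over scalars and vectors. Decoding leaves a single
  -- candidate, so each quantifier turns into a condition on the tag.
  ∃scalar : ∀ m {P : ℚ → Set} → (∃[ a ] (decode k m ≡ inj₁ a × P a)) ⇔ (π₁ m ≡ 0 × P (rational (π₂ m)))
  ∃scalar m {P} = mk⇔ forth (λ (e , p) → _ , decode-scalar k m e , p)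
    where
    forth : (∃[ a ] (decode k m ≡ inj₁ a × P a)) → π₁ m ≡ 0 × P (rational (π₂ m))
    forth (a , e , p) with π₁ m ≟ 0
    forth (a , refl , p) | yes tag = tag , p
    forth (a , ()   , p) | no  _

  ∃vector : ∀ m {P : Vec ℚ k → Set} → (∃[ u ] (decode k m ≡ inj₂ u × P u)) ⇔ (π₁ m ≢ 0 × P (coordinates k (π₂ m)))
  ∃vector m {P} = mk⇔ forth (λ (ne , p) → _ , decode-vector k m ne , p)
    where
    forth : (∃[ u ] (decode k m ≡ inj₂ u × P u)) → π₁ m ≢ 0 × P (coordinates k (π₂ m))
    forth (u , e , p) with π₁ m ≟ 0
    forth (u , ()   , p) | yes _
    forth (u , refl , p) | no ne = ne , p

  scalar≡ : ∀ m b → decode k m ≡ inj₁ b ⇔ (π₁ m ≡ 0 × rational (π₂ m) ≡ b)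
  scalar≡ m b = ⇔-trans (mk⇔ (λ e → b , e , refl) (λ { (_ , e , refl) → e })) (∃scalar m {_≡ b})

  vector≡ : ∀ m w → decode k m ≡ inj₂ w ⇔ (π₁ m ≢ 0 × coordinates k (π₂ m) ≡ w)
  vector≡ m w = ⇔-trans (mk⇔ (λ e → w , e , refl) (λ { (_ , e , refl) → e })) (∃vector m {_≡ w})

  tabulate≡ : ∀ {p q : ℕ → ℚ} → tabulate {n = k} (p ∘ toℕ) ≡ tabulate (q ∘ toℕ) ⇔ (∀ i → i < k → p i ≡ q i)
  tabulate≡ {p} {q} = ⇔-trans
    (mk⇔ (λ e i → trans (sym (Vecₚ.lookup∘tabulate (p ∘ toℕ) i)) (trans (cong (λ w → lookup w i) e) (Vecₚ.lookup∘tabulate (q ∘ toℕ) i)))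
         Vecₚ.tabulate-cong)
    (⇔-sym ∀<⇔∀Fin)

  coordinates-0 : Vec.replicate k 0ℚ ≡ tabulate (λ i → rational 0)
  coordinates-0 = lookup-ext λ i → trans (Vecₚ.lookup-replicate i 0ℚ) (trans (sym rational-0) (sym (Vecₚ.lookup∘tabulate _ i)))

  coordinates-+ : ∀ x y → Vec.zipWith ℚ._+_ (coordinates k x) (coordinates k y) ≡
                          tabulate (λ i → rational (nth x (toℕ i)) ℚ.+ rational (nth y (toℕ i)))
  coordinates-+ x y = lookup-ext λ i → trans (Vecₚ.lookup-zipWith ℚ._+_ i (coordinates k x) (coordinates k y))
    (trans (cong₂ ℚ._+_ (Vecₚ.lookup∘tabulate _ i) (Vecₚ.lookup∘tabulate _ i)) (sym (Vecₚ.lookup∘tabulate _ i)))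

  coordinates-* : ∀ a y → Vec.map (a ℚ.*_) (coordinates k y) ≡ tabulate (λ i → a ℚ.* rational (nth y (toℕ i)))
  coordinates-* a y = sym (Vecₚ.tabulate-∘ (a ℚ.*_) _)

private
  ×-⇔ : ∀ {A B C : Set} → B ⇔ C → (A × B) ⇔ (A × C)
  ×-⇔ e = mk⇔ (map₂ (to e)) (map₂ (from e))

  ∃-out : ∀ {A B : Set} {P : A → Set} {Q : A → B → Set} {S : A → B → Set} →
          (∃[ a ] ∃[ b ] (P a × Q a b × S a b)) ⇔ (∃[ a ] (P a × ∃[ b ] (Q a b × S a b)))
  ∃-out = mk⇔ (λ (a , b , p , q , s) → a , p , b , q , s) (λ (a , p , b , q , s) → a , b , p , q , s)

args : ∀ i → ℕ → Vec ℕ (VS-arity i)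
args i r = tabulate (λ j → item r (toℕ j))

-- The dimension is an input of the program: identities between vectors hold coordinatewise and
-- become universal statements over the indices below `f ρ`.
relationᶜ : ∀ i → Computable f → Computable g →
            Decidableᶜ (λ ρ → QVS-R (f ρ) i (Vec.map (decode (f ρ)) (args i (g ρ))))
relationᶜ {f = f} {g} i k r = go i
  where
  x = itemᶜ r (lit 0)
  y = itemᶜ r (lit 1)
  z = itemᶜ r (lit 2)
  X Y Z : ∀ ρ → ℕ
  X ρ = item (g ρ) 0
  Y ρ = item (g ρ) 1
  Z ρ = item (g ρ) 2
  go : ∀ i → Decidableᶜ (λ ρ → QVS-R (f ρ) i (Vec.map (decode (f ρ)) (args i (g ρ))))
  go 0F = mapᵈ (λ ρ → ⇔-trans (mk⇔ (λ ne → ne , _) proj₁)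
                        (⇔-trans (⇔-sym (∃vector (f ρ) (X ρ) {λ _ → ⊤}))
                                 (mk⇔ (map₂ proj₁) (map₂ (_, _)))))
            (¬ᶜ (π₁ᶜ x ≡ᶜ lit 0))
  go 1F = mapᵈ (λ ρ → ⇔-trans (mk⇔ (λ e → e , _) proj₁)
                        (⇔-trans (⇔-sym (∃scalar (f ρ) (X ρ) {λ _ → ⊤}))
                                 (mk⇔ (map₂ proj₁) (map₂ (_, _)))))
            (π₁ᶜ x ≡ᶜ lit 0)
  go 2F = mapᵈ (λ ρ → ⇔-trans (⇔-reflexive (λ q → π₁ (X ρ) ≡ 0 × rational (π₂ (X ρ)) ≡ q) (rational-code 0ℚ))
                              (⇔-sym (scalar≡ (f ρ) (X ρ) 0ℚ)))
            ((π₁ᶜ x ≡ᶜ lit 0) ∧ᶜ rational-≡ᶜ (π₂ᶜ x) (lit (code 0ℚ)))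
  go 3F = mapᵈ (λ ρ → ⇔-trans (⇔-reflexive (λ q → π₁ (X ρ) ≡ 0 × rational (π₂ (X ρ)) ≡ q) (rational-code 1ℚ))
                              (⇔-sym (scalar≡ (f ρ) (X ρ) 1ℚ)))
            ((π₁ᶜ x ≡ᶜ lit 0) ∧ᶜ rational-≡ᶜ (π₂ᶜ x) (lit (code 1ℚ)))
  go 4F = mapᵈ (λ ρ → ⇔-sym (⇔-trans ∃-out (⇔-trans (∃scalar (f ρ) (X ρ))
                (×-⇔ (⇔-trans (∃scalar (f ρ) (Y ρ)) (×-⇔ (scalar≡ (f ρ) (Z ρ) _)))))))
            ((π₁ᶜ x ≡ᶜ lit 0) ∧ᶜ (π₁ᶜ y ≡ᶜ lit 0) ∧ᶜ (π₁ᶜ z ≡ᶜ lit 0) ∧ᶜ rational-+ᶜ (π₂ᶜ x) (π₂ᶜ y) (π₂ᶜ z))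
  go 5F = mapᵈ (λ ρ → ⇔-sym (⇔-trans ∃-out (⇔-trans (∃scalar (f ρ) (X ρ))
                (×-⇔ (⇔-trans (∃scalar (f ρ) (Y ρ)) (×-⇔ (scalar≡ (f ρ) (Z ρ) _)))))))
            ((π₁ᶜ x ≡ᶜ lit 0) ∧ᶜ (π₁ᶜ y ≡ᶜ lit 0) ∧ᶜ (π₁ᶜ z ≡ᶜ lit 0) ∧ᶜ rational-*ᶜ (π₂ᶜ x) (π₂ᶜ y) (π₂ᶜ z))
  go 6F = mapᵈ (λ ρ → ⇔-sym (⇔-trans (vector≡ (f ρ) (X ρ) _) (×-⇔ (⇔-trans
                (⇔-reflexive (coordinates (f ρ) (π₂ (X ρ)) ≡_) (coordinates-0 (f ρ))) (tabulate≡ (f ρ))))))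
            (¬ᶜ (π₁ᶜ x ≡ᶜ lit 0) ∧ᶜ ∀<ᶜ k (rational-≡ᶜ (nthᶜ (weaken (π₂ᶜ x)) (var 0F)) (lit 0)))
  go 7F = mapᵈ (λ ρ → ⇔-sym (⇔-trans ∃-out (⇔-trans (∃vector (f ρ) (X ρ))
                (×-⇔ (⇔-trans (∃vector (f ρ) (Y ρ)) (×-⇔ (⇔-trans (vector≡ (f ρ) (Z ρ) _) (×-⇔ (⇔-trans
                (⇔-reflexive (coordinates (f ρ) (π₂ (Z ρ)) ≡_) (coordinates-+ (f ρ) (π₂ (X ρ)) (π₂ (Y ρ)))) (tabulate≡ (f ρ)))))))))))
            (¬ᶜ (π₁ᶜ x ≡ᶜ lit 0) ∧ᶜ ¬ᶜ (π₁ᶜ y ≡ᶜ lit 0) ∧ᶜ ¬ᶜ (π₁ᶜ z ≡ᶜ lit 0) ∧ᶜ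
             ∀<ᶜ k (rational-+ᶜ (nthᶜ (weaken (π₂ᶜ x)) (var 0F)) (nthᶜ (weaken (π₂ᶜ y)) (var 0F)) (nthᶜ (weaken (π₂ᶜ z)) (var 0F))))
  go 8F = mapᵈ (λ ρ → ⇔-sym (⇔-trans ∃-out (⇔-trans (∃scalar (f ρ) (X ρ))
                (×-⇔ (⇔-trans (∃vector (f ρ) (Y ρ)) (×-⇔ (⇔-trans (vector≡ (f ρ) (Z ρ) _) (×-⇔ (⇔-trans
                (⇔-reflexive (coordinates (f ρ) (π₂ (Z ρ)) ≡_) (coordinates-* (f ρ) (rational (π₂ (X ρ))) (π₂ (Y ρ)))) (tabulate≡ (f ρ)))))))))))
            ((π₁ᶜ x ≡ᶜ lit 0) ∧ᶜ ¬ᶜ (π₁ᶜ y ≡ᶜ lit 0) ∧ᶜ ¬ᶜ (π₁ᶜ z ≡ᶜ lit 0) ∧ᶜ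
             ∀<ᶜ k (rational-*ᶜ (weaken (π₂ᶜ x)) (nthᶜ (weaken (π₂ᶜ y)) (var 0F)) (nthᶜ (weaken (π₂ᶜ z)) (var 0F))))

item-lookup-vec : ∀ {n} (v : Vec ℕ n) i → item ⌜ v ⌝ (toℕ i) ≡ lookup v i
item-lookup-vec (x ∷ v) 0F          = π₁-⟪⟫ x ⌜ v ⌝
item-lookup-vec (x ∷ v) (Fin.suc i) = trans (item-∷ x ⌜ v ⌝ (toℕ i)) (item-lookup-vec v i)

args-code : ∀ i (v : Vec ℕ (VS-arity i)) → args i ⌜ v ⌝ ≡ v
args-code i v = trans (Vecₚ.tabulate-cong (item-lookup-vec v)) (Vecₚ.tabulate∘lookup v)

module _ (k : ℕ) where

  ∃preimage : ∀ {n} (v : Vec ℕ n) {P : Vec (ℚ ⊎ Vec ℚ k) n → Set} →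
              (∃ λ xs → Vec.map (numberOf k) xs ≡ v × P xs) ⇔
              (Vec.map (numberOf k) (Vec.map (decode k) v) ≡ v × P (Vec.map (decode k) v))
  ∃preimage v {P} = mk⇔
    (λ { (xs , refl , p) → cong (Vec.map (numberOf k)) (map-inverse (decode-numberOf k) xs)
                         , subst P (sym (map-inverse (decode-numberOf k) xs)) p })
    (λ (e , p) → _ , e , p)

  items-valid : ∀ {n} (v : Vec ℕ n) →
                (∀ j → j < n → Valid k (item ⌜ v ⌝ j)) ⇔ Vec.map (numberOf k) (Vec.map (decode k) v) ≡ v
  items-valid v = ⇔-trans ∀<⇔∀Fin (mk⇔
    (λ valid → lookup-ext λ j → trans (Vecₚ.lookup-map j (numberOf k) (Vec.map (decode k) v))
      (trans (cong (numberOf k) (Vecₚ.lookup-map j (decode k) v))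
             (numberOf-decode k (lookup v j) (subst (Valid k) (item-lookup-vec v j) (valid j)))))
    (λ e j → subst (Valid k)
      (trans (sym (Vecₚ.lookup-map j (numberOf k) (Vec.map (decode k) v)))
             (trans (cong (λ w → lookup w j) e) (sym (item-lookup-vec v j))))
      (numberOf-valid k (lookup (Vec.map (decode k) v) j))))

-- Arithmetical truth of literals in the spaces

Signed : ℕ → Set → Set
Signed s P = (s ≡ 1 × P) ⊎ (s ≡ 0 × ¬ P)

EqualityTrue : ℕ → ℕ → ℕ → Set
EqualityTrue k s r = Valid k (π₁ r) × Valid k (π₂ r) × Signed s (π₁ r ≡ π₂ r)

RelationTrue : ℕ → ℕ → Fin 9 → ℕ → Set
RelationTrue k s i r = (∀ j → j < VS-arity i → Valid k (item r j)) ×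
                       Signed s (QVS-R k i (Vec.map (decode k) (args i r)))

Signedᶜ : ∀ {P : Vec ℕ n → Set} → Computable f → Decidableᶜ P → Decidableᶜ (λ ρ → Signed (f ρ) (P ρ))
Signedᶜ s p = ((s ≡ᶜ lit 1) ∧ᶜ p) ∨ᶜ ((s ≡ᶜ lit 0) ∧ᶜ ¬ᶜ p)

-- Here s is the sign, t the symbol with 0 reserved for equality, and r the code of the arguments.
data LiteralTrue (k s t r : ℕ) : Set where
  equality : t ≡ 0 → EqualityTrue k s r → LiteralTrue k s t r
  relation : ∀ i → t ≡ suc (toℕ i) → RelationTrue k s i r → LiteralTrue k s t r

record SpaceTrue (k p : ℕ) : Set where
  constructor decoded
  field literal : LiteralTrue k (π₁ p) (π₁ (π₂ p)) (π₂ (π₂ p))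

open SpaceTrue

SpaceTrueᶜ : Computable f → Computable g → Decidableᶜ (λ ρ → SpaceTrue (f ρ) (g ρ))
SpaceTrueᶜ k p = mapᵈ
  (λ ρ → mk⇔ (λ { (inj₁ (e , h)) → decoded (equality e h) ; (inj₂ (i , e , h)) → decoded (relation i e h) })
             (λ { (decoded (equality e h)) → inj₁ (e , h) ; (decoded (relation i e h)) → inj₂ (i , e , h) }))
  (
  ((t ≡ᶜ lit 0) ∧ᶜ Validᶜ k (π₁ᶜ r) ∧ᶜ Validᶜ k (π₂ᶜ r) ∧ᶜ Signedᶜ s (π₁ᶜ r ≡ᶜ π₂ᶜ r)) ∨ᶜ
  ⋁ᶜ (λ i → (t ≡ᶜ lit (suc (toℕ i))) ∧ᶜ
            ∀<ᶜ (lit (VS-arity i)) (Validᶜ (weaken k) (itemᶜ (weaken r) (var 0F))) ∧ᶜ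
            Signedᶜ s (relationᶜ i k r)))
  where
  s = π₁ᶜ p
  t = π₁ᶜ (π₂ᶜ p)
  r = π₂ᶜ (π₂ᶜ p)

SpaceTrue-⟪⟫ : ∀ k s t r → SpaceTrue k ⟪ s , ⟪ t , r ⟫ ⟫ ⇔ LiteralTrue k s t r
SpaceTrue-⟪⟫ k s t r = ⇔-trans (mk⇔ literal decoded) (⇔-trans
  (⇔-reflexive (λ (s , p) → LiteralTrue k s (π₁ p) (π₂ p)) (cong₂ _,_ (π₁-⟪⟫ s ⟪ t , r ⟫) (π₂-⟪⟫ s ⟪ t , r ⟫)))
  (⇔-reflexive (λ (t , r) → LiteralTrue k s t r) (cong₂ _,_ (π₁-⟪⟫ t r) (π₂-⟪⟫ t r))))

EqualityTrue-⟪⟫ : ∀ k s a b → EqualityTrue k s ⟪ a , b ⟫ ⇔ (Valid k a × Valid k b × Signed s (a ≡ b))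
EqualityTrue-⟪⟫ k s a b rewrite π₁-⟪⟫ a b | π₂-⟪⟫ a b = ⇔-refl

LiteralTrue-eq : ∀ k s a b → LiteralTrue k s 0 ⟪ a , b ⟫ ⇔ (Valid k a × Valid k b × Signed s (a ≡ b))
LiteralTrue-eq k s a b = ⇔-trans (mk⇔ (λ { (equality _ t) → t ; (relation _ () _) }) (equality refl)) (EqualityTrue-⟪⟫ k s a b)

LiteralTrue-R : ∀ k s i (v : Vec ℕ (VS-arity i)) → LiteralTrue k s (suc (toℕ i)) ⌜ v ⌝ ⇔
                (Vec.map (numberOf k) (Vec.map (decode k) v) ≡ v × Signed s (QVS-R k i (Vec.map (decode k) v)))
LiteralTrue-R k s i v = mk⇔
  (λ { (equality () _) ; (relation i′ e t) → forth i′ (toℕ-injective (suc-injective e)) t })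
  (λ (e , t) → relation i refl (from (items-valid k v) e , from holds t))
  where
  holds : Signed s (QVS-R k i (Vec.map (decode k) (args i ⌜ v ⌝))) ⇔ Signed s (QVS-R k i (Vec.map (decode k) v))
  holds = ⇔-reflexive (λ w → Signed s (QVS-R k i (Vec.map (decode k) w))) (args-code i v)
  forth : ∀ i′ → i ≡ i′ → RelationTrue k s i′ ⌜ v ⌝ →
          Vec.map (numberOf k) (Vec.map (decode k) v) ≡ v × Signed s (QVS-R k i (Vec.map (decode k) v))
  forth _ refl (valid , t) = to (items-valid k v) valid , to holds t

Signed-1 : ∀ {P : Set} → Signed 1 P ⇔ P
Signed-1 = mk⇔ (λ { (inj₁ (_ , p)) → p ; (inj₂ (() , _)) }) (λ p → inj₁ (refl , p))

Signed-0 : ∀ {P : Set} → Signed 0 P ⇔ (¬ P)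
Signed-0 = mk⇔ (λ { (inj₁ (() , _)) ; (inj₂ (_ , p)) → p }) (λ p → inj₂ (refl , p))

code-, : ∀ {A B : Set} {{_ : Code A}} {{_ : Code B}} (a : A) (b : B) → ⌜ (a , b) ⌝ ≡ ⟪ ⌜ a ⌝ , ⌜ b ⌝ ⟫
code-, a b = refl

code-eq : ∀ {L} a b → ⌜ eq {L} a b ⌝ ≡ ⟪ 0 , ⟪ a , b ⟫ ⟫
code-eq a b = refl

code-R : ∀ {L} i (v : Vec ℕ (arity L i)) → ⌜ R[_]_ {L} i v ⌝ ≡ ⟪ suc (toℕ i) , ⌜ v ⌝ ⟫
code-R i v = refl

SpaceTrue-eq : ∀ k (s : Bool) a b → SpaceTrue k ⌜ (s , eq {VS-Lang} a b) ⌝ ⇔ (Valid k a × Valid k b × Signed ⌜ s ⌝ (a ≡ b))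
SpaceTrue-eq k s a b = ⇔-trans
  (⇔-reflexive (SpaceTrue k) (trans (code-, s (eq {VS-Lang} a b)) (cong ⟪ ⌜ s ⌝ ,_⟫ (code-eq {VS-Lang} a b))))
  (⇔-trans (SpaceTrue-⟪⟫ k ⌜ s ⌝ 0 ⟪ a , b ⟫) (LiteralTrue-eq k ⌜ s ⌝ a b))

SpaceTrue-R : ∀ k (s : Bool) i (v : Vec ℕ (VS-arity i)) → SpaceTrue k ⌜ (s , R[_]_ {VS-Lang} i v) ⌝ ⇔
              (Vec.map (numberOf k) (Vec.map (decode k) v) ≡ v × Signed ⌜ s ⌝ (QVS-R k i (Vec.map (decode k) v)))
SpaceTrue-R k s i v = ⇔-trans
  (⇔-reflexive (SpaceTrue k) (trans (code-, s (R[_]_ {VS-Lang} i v)) (cong ⟪ ⌜ s ⌝ ,_⟫ (code-R {VS-Lang} i v))))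
  (⇔-trans (SpaceTrue-⟪⟫ k ⌜ s ⌝ (suc (toℕ i)) ⌜ v ⌝) (LiteralTrue-R k ⌜ s ⌝ i v))

D-space : ∀ k φ → D (space k) φ ⇔ SpaceTrue k ⌜ φ ⌝
D-space k (true , eq a b) = ⇔-sym (⇔-trans (SpaceTrue-eq k true a b) (mk⇔
  (λ (va , _ , e) → from (space-dom k a) va , to Signed-1 e)
  (λ { (t , refl) → to (space-dom k a) t , to (space-dom k a) t , from Signed-1 refl })))
D-space k (false , eq a b) = ⇔-sym (⇔-trans (SpaceTrue-eq k false a b) (mk⇔
  (λ (va , vb , e) → from (space-dom k a) va , from (space-dom k b) vb , to Signed-0 e)
  (λ (t , u , ne) → to (space-dom k a) t , to (space-dom k b) u , from Signed-0 ne)))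
D-space k (true , R[ i ] v) = ⇔-trans (D-copy-true (numbering k) i v) (⇔-trans (∃preimage k v {QVS-R k i})
  (⇔-sym (⇔-trans (SpaceTrue-R k true i v) (mk⇔ (map₂ (to Signed-1)) (map₂ (from Signed-1))))))
D-space k (false , R[ i ] v) = ⇔-trans (D-copy-false (numbering k) i v) (⇔-trans (∃preimage k v {λ xs → ¬ QVS-R k i xs})
  (⇔-sym (⇔-trans (SpaceTrue-R k false i v) (mk⇔ (map₂ (to Signed-0)) (map₂ (from Signed-0))))))

-- The pairs which have to be kept apart for a linear map to reflect a relation at given arguments.
critical : ∀ {m} i → Vec (ℚ ⊎ Vec ℚ m) (VS-arity i) → List ((ℚ ⊎ Vec ℚ m) × (ℚ ⊎ Vec ℚ m))
critical 6F (x ∷ [])                        = (x , inj₂ (Vec.replicate _ 0ℚ)) ∷ []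
critical 7F (inj₂ u ∷ inj₂ v ∷ z ∷ [])      = (z , inj₂ (Vec.zipWith ℚ._+_ u v)) ∷ []
critical 8F (inj₁ a ∷ inj₂ v ∷ z ∷ [])      = (z , inj₂ (Vec.map (a ℚ.*_) v)) ∷ []
critical _  _                               = []

module LinearMap {m n} {φ : Vec ℚ m → Vec ℚ n} (lin : Semilinear id φ) where

  onScalarsId : ℚ ⊎ Vec ℚ m → ℚ ⊎ Vec ℚ n
  onScalarsId = Sum.map₂ φ

  φ-0 : φ (Vec.replicate m 0ℚ) ≡ Vec.replicate n 0ℚ
  φ-0 = begin
    φ (Vec.replicate m 0ℚ)                        ≡⟨ cong φ (map-0* (Vec.replicate m 0ℚ)) ⟨
    φ (Vec.map (0ℚ ℚ.*_) (Vec.replicate m 0ℚ))    ≡⟨ homogeneous lin 0ℚ _ ⟩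
    Vec.map (0ℚ ℚ.*_) (φ (Vec.replicate m 0ℚ))    ≡⟨ map-0* _ ⟩
    Vec.replicate n 0ℚ                            ∎
    where open ≡-Reasoning

  preserves : ∀ i xs → QVS-R m i xs → QVS-R n i (Vec.map onScalarsId xs)
  preserves 0F (_ ∷ []) (u , refl) = φ u , refl
  preserves 1F (_ ∷ []) (a , refl) = a , refl
  preserves 2F (_ ∷ []) refl = refl
  preserves 3F (_ ∷ []) refl = refl
  preserves 4F (_ ∷ _ ∷ _ ∷ []) (a , b , refl , refl , refl) = a , b , refl , refl , refl
  preserves 5F (_ ∷ _ ∷ _ ∷ []) (a , b , refl , refl , refl) = a , b , refl , refl , refl
  preserves 6F (_ ∷ []) refl = cong inj₂ φ-0
  preserves 7F (_ ∷ _ ∷ _ ∷ []) (u , v , refl , refl , refl) = φ u , φ v , refl , refl , cong inj₂ (additive lin u v)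
  preserves 8F (_ ∷ _ ∷ _ ∷ []) (a , v , refl , refl , refl) = a , φ v , refl , refl , cong inj₂ (homogeneous lin a v)

  Separates : (ℚ ⊎ Vec ℚ m) × (ℚ ⊎ Vec ℚ m) → Set
  Separates (x , y) = onScalarsId x ≡ onScalarsId y → x ≡ y

  -- The map fixes scalars and respects the sorts, so scalar relations are reflected outright. For
  -- the zero vector, sums and multiples it is enough that the last argument is not confused with
  -- the value it should have.
  reflects : ∀ i xs → LAll.All Separates (critical i xs) → QVS-R n i (Vec.map onScalarsId xs) → QVS-R m i xs
  reflects 0F (inj₂ u ∷ []) _ _ = u , refl
  reflects 0F (inj₁ a ∷ []) _ (_ , ())
  reflects 1F (inj₁ a ∷ []) _ _ = a , refl
  reflects 1F (inj₂ u ∷ []) _ (_ , ())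
  reflects 2F (inj₁ a ∷ []) _ refl = refl
  reflects 3F (inj₁ a ∷ []) _ refl = refl
  reflects 4F (inj₁ a ∷ inj₁ b ∷ inj₁ c ∷ []) _ (_ , _ , refl , refl , refl) = a , b , refl , refl , refl
  reflects 4F (inj₁ a ∷ inj₁ b ∷ inj₂ w ∷ []) _ (_ , _ , _ , _ , ())
  reflects 4F (inj₁ a ∷ inj₂ v ∷ _ ∷ []) _ (_ , _ , _ , () , _)
  reflects 4F (inj₂ u ∷ _ ∷ _ ∷ []) _ (_ , _ , () , _)
  reflects 5F (inj₁ a ∷ inj₁ b ∷ inj₁ c ∷ []) _ (_ , _ , refl , refl , refl) = a , b , refl , refl , refl
  reflects 5F (inj₁ a ∷ inj₁ b ∷ inj₂ w ∷ []) _ (_ , _ , _ , _ , ())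
  reflects 5F (inj₁ a ∷ inj₂ v ∷ _ ∷ []) _ (_ , _ , _ , () , _)
  reflects 5F (inj₂ u ∷ _ ∷ _ ∷ []) _ (_ , _ , () , _)
  reflects 6F (x ∷ []) (sep ∷ []) e = sep (trans e (cong inj₂ (sym φ-0)))
  reflects 7F (inj₂ u ∷ inj₂ v ∷ z ∷ []) (sep ∷ []) (_ , _ , refl , refl , e) =
    u , v , refl , refl , sep (trans e (cong inj₂ (sym (additive lin u v))))
  reflects 7F (inj₂ u ∷ inj₁ b ∷ _ ∷ []) _ (_ , _ , _ , () , _)
  reflects 7F (inj₁ a ∷ _ ∷ _ ∷ []) _ (_ , _ , () , _)
  reflects 8F (inj₁ a ∷ inj₂ v ∷ z ∷ []) (sep ∷ []) (_ , _ , refl , refl , e) =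
    a , v , refl , refl , sep (trans e (cong inj₂ (sym (homogeneous lin a v))))
  reflects 8F (inj₁ a ∷ inj₁ b ∷ _ ∷ []) _ (_ , _ , _ , () , _)
  reflects 8F (inj₂ u ∷ _ ∷ _ ∷ []) _ (_ , _ , () , _)

-- Inclusions of spaces by padding with zeros

pad : ∀ {k n} → k ≤ n → Vec ℚ k → Vec ℚ n
pad k≤n = Vec.padRight k≤n 0ℚ

pad-linear : ∀ {k n} (k≤n : k ≤ n) → Semilinear id (pad k≤n)
pad-linear k≤n = record { σ-0 = refl ; additive = pad-+ k≤n ; homogeneous = λ a → pad-* a k≤n }
  where
  pad-+ : ∀ {k n} (k≤n : k ≤ n) u v → pad k≤n (Vec.zipWith ℚ._+_ u v) ≡ Vec.zipWith ℚ._+_ (pad k≤n u) (pad k≤n v)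
  pad-+ z≤n       []      []      = sym (zip-0+ _)
  pad-+ (s≤s k≤n) (x ∷ u) (y ∷ v) = cong (_ ∷_) (pad-+ k≤n u v)
  pad-* : ∀ a {k n} (k≤n : k ≤ n) u → pad k≤n (Vec.map (a ℚ.*_) u) ≡ Vec.map (a ℚ.*_) (pad k≤n u)
  pad-* a z≤n       []      = sym (map-*0 a _)
  pad-* a (s≤s k≤n) (x ∷ u) = cong (_ ∷_) (pad-* a k≤n u)

pad-injective : ∀ {k n} (k≤n : k ≤ n) {u v} → pad k≤n u ≡ pad k≤n v → u ≡ v
pad-injective k≤n {u} {v} e = trans (sym (Vecₚ.truncate-padRight k≤n 0ℚ u))
  (trans (cong (Vec.truncate k≤n) e) (Vecₚ.truncate-padRight k≤n 0ℚ v))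

codeVector-0 : ∀ n → codeVector (Vec.replicate n 0ℚ) ≡ 0
codeVector-0 zero    = refl
codeVector-0 (suc n) = cong₂ ⟪_,_⟫ code-0 (codeVector-0 n)

codeVector-pad : ∀ {k n} (k≤n : k ≤ n) u → codeVector (pad k≤n u) ≡ codeVector u
codeVector-pad {n = n} z≤n [] = codeVector-0 n
codeVector-pad (s≤s k≤n) (x ∷ u) = cong ⟪ code x ,_⟫ (codeVector-pad k≤n u)

-- Padding is linear, hence preserves the relations; it is injective, hence reflects them; and it
-- changes no number.
space-⊆ : ∀ {k n} → k ≤ n → ∀ φ → D (space k) φ → D (space n) φ
space-⊆ {k} {n} k≤n φ = transfer (numbering k) (numbering n) onScalarsId preserves φ (transferable φ)
  where
  open LinearMap (pad-linear k≤n)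
  fixed : ∀ x → numberOf n (onScalarsId x) ≡ numberOf k x
  fixed (inj₁ a) = refl
  fixed (inj₂ u) = cong ⟪ 1 ,_⟫ (codeVector-pad k≤n u)
  separates : ∀ p → Separates p
  separates (inj₁ a , inj₁ b) refl = refl
  separates (inj₂ u , inj₂ v) e    = cong inj₂ (pad-injective k≤n (Sumₚ.inj₂-injective e))
  transferable : ∀ φ → Transferable (numbering k) (numbering n) onScalarsId preserves φ
  transferable (s , eq a b)   x _  = fixed x
  transferable (s , R[ i ] v) xs _ = VAll.universal fixed xs , reflects i xs (LAll.universal separates _)

-- Projecting the plane to a line

infix 4 _≟ᵉ_

_≟ᵉ_ : ∀ {n} → DecidableEquality (ℚ ⊎ Vec ℚ n)
_≟ᵉ_ = Sumₚ.≡-dec ℚₚ._≟_ (Vecₚ.≡-dec ℚₚ._≟_)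

natural : ℕ → ℚ
natural N = fromℚᵘ (mkℚᵘ (ℤ.+ N) 0)

natural-injective : ∀ {N M} → natural N ≡ natural M → N ≡ M
natural-injective {N} {M} e with ℚₚ.fromℚᵘ-injective {mkℚᵘ (ℤ.+ N) 0} {mkℚᵘ (ℤ.+ M) 0} e
... | *≡* e′ = ℤₚ.+-injective (trans (sym (ℤₚ.*-identityʳ (ℤ.+ N))) (trans e′ (ℤₚ.*-identityʳ (ℤ.+ M))))

-- The kernel is spanned by (-N, 1), so different N project along different directions.
slope : ℕ → Vec ℚ 2 → Vec ℚ 1
slope N (p ∷ q ∷ []) = p ℚ.+ natural N ℚ.* q ∷ []

slope-linear : ∀ N → Semilinear id (slope N)
slope-linear N = record
  { σ-0        = refl
  ; additive   = λ { (p ∷ q ∷ []) (p′ ∷ q′ ∷ []) → cong (_∷ []) (ℚS.solve 5 (λ N p q p′ q′ →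
      p :+ p′ :+ N :* (q :+ q′) := (p :+ N :* q) :+ (p′ :+ N :* q′)) refl (natural N) p q p′ q′) }
  ; homogeneous = λ { a (p ∷ q ∷ []) → cong (_∷ []) (ℚS.solve 4 (λ N a p q →
      a :* p :+ N :* (a :* q) := a :* (p :+ N :* q)) refl (natural N) a p q) } }
  where open ℚS using (_:+_; _:*_; _:=_)

-- Subtracting the two equations leaves (c - d)(q - q′) = 0, and c - d is invertible.
slopes-determine : ∀ {c d p q p′ q′} → c ≢ d → p ℚ.+ c ℚ.* q ≡ p′ ℚ.+ c ℚ.* q′ → p ℚ.+ d ℚ.* q ≡ p′ ℚ.+ d ℚ.* q′ →
                   p ≡ p′ × q ≡ q′
slopes-determine {c} {d} {p} {q} {p′} {q′} c≢d e₁ e₂ = p≡p′ , q≡q′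
  where
  open ≡-Reasoning
  open ℚS using (_:+_; _:*_; :-_; _:=_; con)
  δ : ℚ
  δ = c ℚ.- d
  instance
    _ : ℚ.NonZero δ
    _ = ℚ.≢-nonZero (c≢d ∘ x∙y⁻¹≈ε⇒x≈y c d)
  δ*[q-q′] : δ ℚ.* (q ℚ.- q′) ≡ 0ℚ
  δ*[q-q′] = begin
    δ ℚ.* (q ℚ.- q′)
      ≡⟨ ℚS.solve 6 (λ c d p q p′ q′ → (c :+ :- d) :* (q :+ :- q′) :=
           (p :+ c :* q) :+ :- (p :+ d :* q) :+ :- ((p′ :+ c :* q′) :+ :- (p′ :+ d :* q′))) refl c d p q p′ q′ ⟩
    p ℚ.+ c ℚ.* q ℚ.- (p ℚ.+ d ℚ.* q) ℚ.- (p′ ℚ.+ c ℚ.* q′ ℚ.- (p′ ℚ.+ d ℚ.* q′))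
      ≡⟨ cong₂ (λ x y → x ℚ.- y ℚ.- (p′ ℚ.+ c ℚ.* q′ ℚ.- (p′ ℚ.+ d ℚ.* q′))) e₁ e₂ ⟩
    p′ ℚ.+ c ℚ.* q′ ℚ.- (p′ ℚ.+ d ℚ.* q′) ℚ.- (p′ ℚ.+ c ℚ.* q′ ℚ.- (p′ ℚ.+ d ℚ.* q′))
      ≡⟨ ℚₚ.+-inverseʳ (p′ ℚ.+ c ℚ.* q′ ℚ.- (p′ ℚ.+ d ℚ.* q′)) ⟩
    0ℚ ∎
  q≡q′ : q ≡ q′
  q≡q′ = x∙y⁻¹≈ε⇒x≈y q q′ (begin
    q ℚ.- q′                        ≡⟨ ℚₚ.*-identityˡ (q ℚ.- q′) ⟨
    1ℚ ℚ.* (q ℚ.- q′)               ≡⟨ cong (ℚ._* (q ℚ.- q′)) (ℚₚ.*-inverseˡ δ) ⟨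
    ℚ.1/ δ ℚ.* δ ℚ.* (q ℚ.- q′)     ≡⟨ ℚₚ.*-assoc (ℚ.1/ δ) δ (q ℚ.- q′) ⟩
    ℚ.1/ δ ℚ.* (δ ℚ.* (q ℚ.- q′))   ≡⟨ cong (ℚ.1/ δ ℚ.*_) δ*[q-q′] ⟩
    ℚ.1/ δ ℚ.* 0ℚ                   ≡⟨ ℚₚ.*-zeroʳ (ℚ.1/ δ) ⟩
    0ℚ                              ∎)
  p≡p′ : p ≡ p′
  p≡p′ = begin
    p                               ≡⟨ ℚS.solve 2 (λ p x → p := (p :+ x) :+ :- x) refl p (c ℚ.* q) ⟩
    p ℚ.+ c ℚ.* q ℚ.- c ℚ.* q       ≡⟨ cong₂ (λ x y → x ℚ.- c ℚ.* y) e₁ q≡q′ ⟩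
    p′ ℚ.+ c ℚ.* q′ ℚ.- c ℚ.* q′    ≡⟨ ℚS.solve 2 (λ p x → p := (p :+ x) :+ :- x) refl p′ (c ℚ.* q′) ⟨
    p′                              ∎

projection : ℕ → ℚ ⊎ Vec ℚ 2 → ℚ ⊎ Vec ℚ 1
projection N = LinearMap.onScalarsId (slope-linear N)

Collision : ℕ → (ℚ ⊎ Vec ℚ 2) × (ℚ ⊎ Vec ℚ 2) → Set
Collision N (x , y) = projection N x ≡ projection N y × x ≢ y

-- Scalars never collide, and two points of the plane that coincide under two different slopes are
-- equal. So each pair spoils at most one N.
collision-unique : ∀ {N M} p → Collision N p → Collision M p → N ≡ M
collision-unique (inj₁ a , inj₁ .a) (refl , ne) _ = ⊥-elim (ne refl)
collision-unique {N} {M} (inj₂ (p ∷ q ∷ []) , inj₂ (p′ ∷ q′ ∷ [])) (e , ne) (e′ , _) =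
  decidable-stable (N ≟ M) λ N≢M → ne (cong inj₂ (coincide N≢M))
  where
  coincide : N ≢ M → p ∷ q ∷ [] ≡ p′ ∷ q′ ∷ []
  coincide N≢M = let p≡p′ , q≡q′ = slopes-determine (N≢M ∘ natural-injective) (Vecₚ.∷-injectiveˡ (Sumₚ.inj₂-injective e))
                                                    (Vecₚ.∷-injectiveˡ (Sumₚ.inj₂-injective e′))
                 in cong₂ (λ p q → p ∷ q ∷ []) p≡p′ q≡q′

-- The lower bound s allows a restart: if the N found for the remaining pairs is the one spoiled by
-- the first pair, any solution from `suc N` on avoids this pair too.
avoidCollisions : ∀ ps s → ∃[ N ] (s ≤ N × LAll.All (λ p → ¬ Collision N p) ps)
avoidCollisions []             s = s , ≤-refl , []
avoidCollisions ((x , y) ∷ ps) s with avoidCollisions ps s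
... | N , s≤N , none with (projection N x ≟ᵉ projection N y) ×-dec ¬? (x ≟ᵉ y)
...   | no ¬c = N , s≤N , ¬c ∷ none
...   | yes c with avoidCollisions ps (suc N)
...     | M , N<M , none′ = M , ≤-trans s≤N (<⇒≤ N<M) , (λ c′ → <⇒≢ N<M (collision-unique (x , y) c c′)) ∷ none′

separating : ∀ ps → ∃[ N ] (LAll.All (LinearMap.Separates (slope-linear N)) ps)
separating ps with avoidCollisions ps 0
... | N , _ , none = N , LAll.map (λ {(x , y)} ¬c e → decidable-stable (x ≟ᵉ y) (λ ne → ¬c (e , ne))) none

-- A numbering of ℚ¹ which gives f x the number of x in space k, for the finitely many x in X;
-- all other elements are moved out of the way, since no number of space k is a pair ⟪ 2 , _ ⟫.
module Patch {k} (f : ℚ ⊎ Vec ℚ k → ℚ ⊎ Vec ℚ 1) (X : List (ℚ ⊎ Vec ℚ k))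
             (f-injective : ∀ {x y} → x ∈ X → y ∈ X → f x ≡ f y → x ≡ y) where

  named? : ∀ y → Dec (LAny.Any (λ x → f x ≡ y) X)
  named? y = LAny.any? (λ x → f x ≟ᵉ y) X

  name : ∀ y → Dec (LAny.Any (λ x → f x ≡ y) X) → ℕ
  name y (yes p) = numberOf k (proj₁ (find p))
  name y (no _)  = ⟪ 2 , numberOf 1 y ⟫

  number′ : ℚ ⊎ Vec ℚ 1 → ℕ
  number′ y = name y (named? y)

  number′-named : ∀ {x} → x ∈ X → number′ (f x) ≡ numberOf k x
  number′-named {x} x∈X with named? (f x)
  ... | yes p = let _ , x′∈X , e = find p in cong (numberOf k) (f-injective x′∈X x∈X e)
  ... | no ¬p = ⊥-elim (¬p (lose x∈X refl))

  numberOf≢⟪2⟫ : ∀ x b → numberOf k x ≢ ⟪ 2 , b ⟫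
  numberOf≢⟪2⟫ (inj₁ a) b e with ⟪⟫-injective 0 (code a) 2 b e
  ... | () , _
  numberOf≢⟪2⟫ (inj₂ u) b e with ⟪⟫-injective 1 (codeVector u) 2 b e
  ... | () , _

  name-injective : ∀ y z p q → name y p ≡ name z q → y ≡ z
  name-injective y z (yes p) (yes q) e =
    let x , _ , fx≡y = find p
        x′ , _ , fx′≡z = find q
    in trans (sym fx≡y) (trans (cong f (injective (numbering k) {x} {x′} e)) fx′≡z)
  name-injective y z (yes p) (no _)  e = ⊥-elim (numberOf≢⟪2⟫ (proj₁ (find p)) (numberOf 1 z) e)
  name-injective y z (no _)  (yes q) e = ⊥-elim (numberOf≢⟪2⟫ (proj₁ (find q)) (numberOf 1 y) (sym e))
  name-injective y z (no _)  (no _)  e =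
    injective (numbering 1) {y} {z} (proj₂ (⟪⟫-injective 2 (numberOf 1 y) 2 (numberOf 1 z) e))

  numbered? : ∀ n → Dec (∃ λ y → number′ y ≡ n)
  numbered? n with LAny.any? (λ x → number′ (f x) ≟ n) X
  ... | yes p = let x , _ , e = find p in yes (f x , e)
  -- Now n can only number an element outside the image of `X`; such a number is a pair whose second
  -- component reveals the element.
  ... | no ¬p with number′ (decode 1 (π₂ n)) ≟ n
  ...   | yes e  = yes (decode 1 (π₂ n) , e)
  ...   | no ne = no λ (y , e) → absent y (named? y) refl e
    where
    absent : ∀ y d → named? y ≡ d → number′ y ≢ n
    absent y (yes p) _ e = let x , x∈X , fx≡y = find p in ¬p (lose x∈X (trans (cong number′ fx≡y) e))
    absent y (no _) d≡ e = ne (trans (cong number′ (trans (cong (decode 1) π₂n) (decode-numberOf 1 y))) e)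
      where
      π₂n : π₂ n ≡ numberOf 1 y
      π₂n = trans (cong π₂ (trans (sym e) (cong (name y) d≡))) (π₂-⟪⟫ 2 (numberOf 1 y))

  patched : Numbering (QVS 1)
  patched = record
    { number    = number′
    ; injective = λ {y} {z} → name-injective y z (named? y) (named? z)
    ; image?    = numbered?
    ; R?        = QVS-R? 1 }

constants : Literal VS-Lang → List ℕ
constants (_ , eq a b)   = a ∷ b ∷ []
constants (_ , R[ i ] v) = Vec.toList v

criticalPairs : Literal VS-Lang → List ((ℚ ⊎ Vec ℚ 2) × (ℚ ⊎ Vec ℚ 2))
criticalPairs (_ , eq a b)   = []
criticalPairs (_ , R[ i ] v) = critical i (Vec.map (decode 2) v)

-- A finite part of the diagram of a plane is realised in a line: project along a direction in general position.
plane-in-line : ∀ α → LAll.All (D (space 2)) α → ∃[ N ] (LAll.All (D (copy {X = QVS 1} N)) α)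
plane-in-line α α⊆ = patched , LAll.tabulate (λ {φ} φ∈α →
    transfer (numbering 2) patched (projection N) preserves φ (transferable φ φ∈α) (LAll.lookup α⊆ φ∈α))
  where
  elements : Literal VS-Lang → List (ℚ ⊎ Vec ℚ 2)
  elements φ = List.map (decode 2) (constants φ)
  X : List (ℚ ⊎ Vec ℚ 2)
  X = concatMap elements α
  -- Pairs of named elements make the projection injective on `X`; the critical pairs let it reflect
  -- the relations that occur in `α`.
  generic : ∃[ N ] (LAll.All (LinearMap.Separates (slope-linear N)) (cartesianProduct X X ++ concatMap criticalPairs α))
  generic = separating _
  N = proj₁ generic
  open LinearMap (slope-linear N)
  separates : ∀ {x y} → x ∈ X → y ∈ X → projection N x ≡ projection N y → x ≡ y
  separates x∈X y∈X = LAll.lookup (proj₂ generic) (∈-++⁺ˡ (∈-cartesianProduct⁺ x∈X y∈X))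
  open Patch (projection N) X separates
  fixed : ∀ {φ} → φ ∈ α → ∀ x {a} → numberOf 2 x ≡ a → a ∈ constants φ → Fixed (numbering 2) patched (projection N) preserves x
  fixed {φ} φ∈α x refl a∈φ = number′-named (subst (_∈ X) (decode-numberOf 2 x)
    (∈-concatMap⁺ elements (lose φ∈α (∈-map⁺ (decode 2) a∈φ))))
  transferable : ∀ φ → φ ∈ α → Transferable (numbering 2) patched (projection N) preserves φ
  transferable (s , eq a b)   φ∈α x  (inj₁ e) = fixed φ∈α x e (here refl)
  transferable (s , eq a b)   φ∈α x  (inj₂ e) = fixed φ∈α x e (there (here refl))
  transferable (s , R[ i ] v) φ∈α xs e = all xs v e id , reflects i xs (LAll.tabulate λ p∈ →
      LAll.lookup (proj₂ generic) (∈-++⁺ʳ (cartesianProduct X X) (∈-concatMap⁺ criticalPairs (lose φ∈α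
        (subst (λ ys → _ ∈ critical i ys) xs≡ p∈)))))
    where
    xs≡ : xs ≡ Vec.map (decode 2) v
    xs≡ = trans (sym (map-inverse (decode-numberOf 2) xs)) (cong (Vec.map (decode 2)) e)
    all : ∀ {n} (xs : Vec (ℚ ⊎ Vec ℚ 2) n) w → Vec.map (numberOf 2) xs ≡ w →
          (∀ {a} → a ∈ Vec.toList w → a ∈ Vec.toList v) →
          VAll.All (Fixed (numbering 2) patched (projection N) preserves) xs
    all []       _ refl _   = []
    all (x ∷ xs) _ refl sub = fixed φ∈α x refl (sub (here refl)) ∷ all xs _ refl (sub ∘ there)

copy-≅ : ∀ {L} {X : AStr L} (M N : Numbering X) → copy M ≅ copy N
copy-≅ {X = X} M N = ≅ᴬ-trans {X = toAStr (copy M)} {X} {toAStr (copy N)} (copy≅ M) (≅ᴬ-sym {X = toAStr (copy N)} {X} (copy≅ N))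

copy-≅⁻ : ∀ {L} {X Y : AStr L} (M : Numbering X) (N : Numbering Y) → copy M ≅ copy N → X ≅ᴬ Y
copy-≅⁻ {X = X} {Y} M N e = ≅ᴬ-trans {X = X} {toAStr (copy M)} {Y} (≅ᴬ-sym {X = toAStr (copy M)} {X} (copy≅ M))
  (≅ᴬ-trans {X = toAStr (copy M)} {toAStr (copy N)} {Y} e (copy≅ N))

-- No embedding of vector spaces into linear orders

FVS≰FLO : ¬ (FVS ≤c FLO)
FVS≰FLO E = 1≢2 (QVS-dimension (copy-≅⁻ (numbering 1) (numbering 2) line≅plane))
  where
  open Embedding E renaming (trans to transformation)
  1≢2 : 1 ≢ 2
  1≢2 ()
  image : ∀ {k} (N : Numbering (QVS k)) → ∃[ B ] (FLO B × copy N ⟶[ Φ transformation ] B)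
  image {k} N = total transformation (copy N) (k , copy≅ N)
  Image : ∀ {k} → Numbering (QVS k) → Structure LO-Lang
  Image N = proj₁ (image N)
  cardinality : ∀ {k} (N : Numbering (QVS k)) → ℕ
  cardinality N = proj₁ (proj₁ (proj₂ (image N)))
  ordered : ∀ {k} (N : Numbering (QVS k)) → toAStr (Image N) ≅ᴬ FinOrd (cardinality N)
  ordered N = proj₂ (proj₁ (proj₂ (image N)))
  mapsTo : ∀ {k} (N : Numbering (QVS k)) → copy N ⟶[ Φ transformation ] Image N
  mapsTo N = proj₂ (proj₂ (image N))
  Image-≅ : ∀ {k l} (M : Numbering (QVS k)) (N : Numbering (QVS l)) → copy M ≅ copy N ⇔ Image M ≅ Image N
  Image-≅ {k} {l} M N = iso (copy M) (copy N) (Image M) (Image N) (k , copy≅ M) (l , copy≅ N) (mapsTo M) (mapsTo N)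
  -- The copy that realises α varies with α. All copies of one space have isomorphic images, so one
  -- cardinality bounds every case.
  ordered′ : ∀ {k} (M N : Numbering (QVS k)) → toAStr (Image M) ≅ᴬ FinOrd (cardinality N)
  ordered′ M N = ≅ᴬ-trans {X = toAStr (Image M)} {toAStr (Image N)} {FinOrd (cardinality N)}
    (to (Image-≅ M N) (copy-≅ M N)) (ordered N)
  Image-≤ : ∀ {k l} (M : Numbering (QVS k)) (N : Numbering (QVS l)) →
            (∀ α → LAll.All (D (copy M)) α → ∃[ N′ ] LAll.All (D (copy {X = QVS l} N′)) α) → cardinality M ≤ cardinality N
  Image-≤ M N realise = image-size-≤ (mapsTo M) (ordered M) λ α α⊆ →
    let N′ , α⊆N′ = realise α α⊆ in copy N′ , Image N′ , α⊆N′ , mapsTo N′ , ordered′ N′ N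
  ≡⇒≅ : ∀ {k l} (M : Numbering (QVS k)) (N : Numbering (QVS l)) → cardinality N ≡ cardinality M → copy M ≅ copy N
  ≡⇒≅ M N e = from (Image-≅ M N) (≅ᴬ-trans {X = toAStr (Image M)} {FinOrd (cardinality M)} {toAStr (Image N)} (ordered M)
    (≅ᴬ-sym {X = toAStr (Image N)} {FinOrd (cardinality M)} (subst (λ n → toAStr (Image N) ≅ᴬ FinOrd n) e (ordered N))))
  line≅plane : copy (numbering 1) ≅ copy (numbering 2)
  line≅plane = ≡⇒≅ (numbering 1) (numbering 2) (≤-antisym
    (Image-≤ (numbering 2) (numbering 1) plane-in-line)
    (Image-≤ (numbering 1) (numbering 2) (λ α α⊆ → numbering 2 , LAll.map (λ {φ} → space-⊆ (s≤s z≤n) φ) α⊆)))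

-- Counting the elements of a linear order

record IsReflexive (c : ℕ) : Set where
  constructor reflexive
  field
    positive : π₁ c ≡ 1
    equation : π₁ (π₂ c) ≡ 0
    sides    : π₁ (π₂ (π₂ c)) ≡ π₂ (π₂ (π₂ c))

IsReflexiveᶜ : Computable f → Decidableᶜ (λ ρ → IsReflexive (f ρ))
IsReflexiveᶜ c = mapᵈ (λ ρ → mk⇔ (λ (p , e , s) → reflexive p e s) (λ (reflexive p e s) → p , e , s))
  ((π₁ᶜ c ≡ᶜ lit 1) ∧ᶜ (π₁ᶜ (π₂ᶜ c) ≡ᶜ lit 0) ∧ᶜ (π₁ᶜ (π₂ᶜ (π₂ᶜ c)) ≡ᶜ π₂ᶜ (π₂ᶜ (π₂ᶜ c))))

IsReflexive-⟪⟫ : ∀ s t r → IsReflexive ⟪ s , ⟪ t , r ⟫ ⟫ ⇔ (s ≡ 1 × t ≡ 0 × π₁ r ≡ π₂ r)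
IsReflexive-⟪⟫ s t r = ⇔-trans
  (mk⇔ (λ (reflexive p e s) → p , e , s) (λ (p , e , s) → reflexive p e s))
  (⇔-trans
    (⇔-reflexive (λ (s , p) → s ≡ 1 × π₁ p ≡ 0 × π₁ (π₂ p) ≡ π₂ (π₂ p)) (cong₂ _,_ (π₁-⟪⟫ s ⟪ t , r ⟫) (π₂-⟪⟫ s ⟪ t , r ⟫)))
    (⇔-reflexive (λ (t , r) → s ≡ 1 × t ≡ 0 × π₁ r ≡ π₂ r) (cong₂ _,_ (π₁-⟪⟫ t r) (π₂-⟪⟫ t r))))

module _ {L : Lang} where

  IsReflexive-code : ∀ (s : Bool) (a : Atom L) {t r} → ⌜ a ⌝ ≡ ⟪ t , r ⟫ →
                     IsReflexive ⌜ (s , a) ⌝ ⇔ (⌜ s ⌝ ≡ 1 × t ≡ 0 × π₁ r ≡ π₂ r)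
  IsReflexive-code s a {t} {r} e = ⇔-trans
    (⇔-reflexive IsReflexive (trans (code-, s a) (cong ⟪ ⌜ s ⌝ ,_⟫ e)))
    (IsReflexive-⟪⟫ ⌜ s ⌝ t r)

  isReflexive⇒ : (ℓ : Literal L) → IsReflexive ⌜ ℓ ⌝ → ∃[ a ] (ℓ ≡ (true , eq a a))
  isReflexive⇒ (s , R[ i ] v) p with to (IsReflexive-code s (R[ i ] v) {suc (toℕ i)} {⌜ v ⌝} (code-R {L} i v)) p
  ... | _ , () , _
  isReflexive⇒ (false , eq a b) p with to (IsReflexive-code false (eq a b) {0} {⟪ a , b ⟫} (code-eq {L} a b)) p
  ... | () , _
  isReflexive⇒ (true , eq a b) p with to (IsReflexive-code true (eq a b) {0} {⟪ a , b ⟫} (code-eq {L} a b)) p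
  ... | _ , _ , e = a , cong (λ b → true , eq a b)
                                  (sym (trans (sym (π₁-⟪⟫ a b)) (trans e (π₂-⟪⟫ a b))))

  isReflexive⇐ : ∀ a → IsReflexive ⌜ (true , eq {L} a a) ⌝
  isReflexive⇐ a = from (IsReflexive-code true (eq a a) {0} {⟪ a , a ⟫} (code-eq {L} a a))
    (refl , refl , trans (π₁-⟪⟫ a a) (sym (π₂-⟪⟫ a a)))

  reflexive-code-injective : ∀ (s : Bool) a b → ⌜ (s , eq {L} a a) ⌝ ≡ ⌜ (s , eq {L} b b) ⌝ → a ≡ b
  reflexive-code-injective s a b e =
    let e′ = proj₂ (⟪⟫-injective ⌜ s ⌝ ⌜ eq {L} a a ⌝ ⌜ s ⌝ ⌜ eq {L} b b ⌝
                      (trans (sym (code-, s (eq {L} a a))) (trans e (code-, s (eq {L} b b)))))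
        e″ = proj₂ (⟪⟫-injective 0 ⟪ a , a ⟫ 0 ⟪ b , b ⟫ (trans (sym (code-eq {L} a a)) (trans e′ (code-eq {L} b b))))
    in proj₁ (⟪⟫-injective a a b b e″)

  -- Equations a = a for k distinct a witness that a structure has at least k elements.
  Counts : List (Literal L) → Set
  Counts α = (∀ i → IsReflexive ⌜ List.lookup α i ⌝) ×
             (∀ i j → toℕ j < toℕ i → ⌜ List.lookup α i ⌝ ≢ ⌜ List.lookup α j ⌝)

  CountsCode : ℕ → ℕ → Set
  CountsCode l k = (∀ i → i < k → IsReflexive (item l i)) × (∀ i → i < k → ∀ j → j < i → item l i ≢ item l j)

  counts-code : ∀ α → Counts α ⇔ CountsCode ⌜ α ⌝ (List.length α)
  counts-code α = mk⇔
    (λ (ref , dist) →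
      from ∀<⇔∀Fin (λ i → subst IsReflexive (sym (item-lookup α i)) (ref i)) ,
      from ∀<⇔∀Fin λ i j j<i e → let j<k = <-trans j<i (toℕ<n i) in
        dist i (fromℕ< j<k) (subst (_< toℕ i) (sym (toℕ-fromℕ< j<k)) j<i)
          (trans (sym (item-lookup α i)) (trans e
            (trans (cong (item ⌜ α ⌝) (sym (toℕ-fromℕ< j<k))) (item-lookup α (fromℕ< j<k))))))
    (λ (ref , dist) →
      (λ i → subst IsReflexive (item-lookup α i) (ref (toℕ i) (toℕ<n i))) ,
      λ i j j<i e → dist (toℕ i) (toℕ<n i) (toℕ j) j<i (trans (item-lookup α i) (trans e (sym (item-lookup α j)))))

  counts-≤ : ∀ {A : Structure L} {n α} → (Universe A ↔ Fin n) → LAll.All (D A) α → Counts α →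
             List.length α ≤ n
  counts-≤ {A} {n} {α} f α⊆A (ref , dist) = injective⇒≤ {f = λ i → Inverse.to f (element i)} λ e →
    lookup-injective (cong proj₁ (↔-to-injective f e))
    where
    a : Fin (List.length α) → ℕ
    a i = proj₁ (isReflexive⇒ (List.lookup α i) (ref i))
    lookup≡ : ∀ i → List.lookup α i ≡ (true , eq (a i) (a i))
    lookup≡ i = proj₂ (isReflexive⇒ (List.lookup α i) (ref i))
    element : Fin (List.length α) → Universe A
    element i = a i , proj₁ (subst (D A) (lookup≡ i) (LAll.lookup α⊆A (∈-lookup i)))
    same : ∀ {i j} → a i ≡ a j → ⌜ List.lookup α i ⌝ ≡ ⌜ List.lookup α j ⌝
    same {i} {j} e = cong (λ ℓ → ⌜ ℓ ⌝) (trans (lookup≡ i) (trans (cong (λ a → true , eq a a) e) (sym (lookup≡ j))))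
    lookup-injective : ∀ {i j} → a i ≡ a j → i ≡ j
    lookup-injective {i} {j} e with <-cmp (toℕ i) (toℕ j)
    ... | tri≈ _ i≡j _ = toℕ-injective i≡j
    ... | tri< i<j _ _ = ⊥-elim (dist j i i<j (same (sym e)))
    ... | tri> _ _ j<i = ⊥-elim (dist i j j<i (same e))

  lookup-tabulate : ∀ {A : Set} {n} (g : Fin n → A) (i : Fin (List.length (List.tabulate g))) →
                    ∃[ j ] (toℕ j ≡ toℕ i × List.lookup (List.tabulate g) i ≡ g j)
  lookup-tabulate {n = suc n} g Fin.zero    = Fin.zero , refl , refl
  lookup-tabulate {n = suc n} g (Fin.suc i) = let j , e , e′ = lookup-tabulate (g ∘ Fin.suc) i in Fin.suc j , cong suc e , e′

  equations : ∀ {n} → (Fin n → ℕ) → List (Literal L)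
  equations b = List.tabulate (λ i → true , eq (b i) (b i))

  equations-count : ∀ {n} (b : Fin n → ℕ) → (∀ {i j} → b i ≡ b j → i ≡ j) → Counts (equations b)
  equations-count b b-injective =
    (λ i → let j , _ , e = lookup-tabulate _ i in subst (λ ℓ → IsReflexive ⌜ ℓ ⌝) (sym e) (isReflexive⇐ (b j))) ,
    λ i j j<i e → let i′ , i′≡i , eᵢ = lookup-tabulate _ i
                      j′ , j′≡j , eⱼ = lookup-tabulate _ j
                      i′≡j′ = b-injective (reflexive-code-injective true (b i′) (b j′)
                                (trans (cong (λ ℓ → ⌜ ℓ ⌝) (sym eᵢ)) (trans e (cong (λ ℓ → ⌜ ℓ ⌝) eⱼ))))
                  in <⇒≢ j<i (trans (sym j′≡j) (trans (cong toℕ (sym i′≡j′)) i′≡i))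

  -- Only equations a = a occur in `α`, so its left sides form the universe of a finite structure in
  -- which the relation may be empty.
  counts-finite : ∀ α → Counts α → ∃[ A ] (FiniteStr {L} A × LAll.All (D A) α)
  counts-finite α (ref , _) = A , (elements , λ n → mk⇔ toWitness fromWitness) , LAll.tabulate λ {ℓ} ℓ∈α → holds ℓ ℓ∈α
    where
    left : Literal L → ℕ
    left (_ , eq a _)   = a
    -- A default value: no literal of `α` has this form.
    left (_ , R[ _ ] _) = 0
    elements : List ℕ
    elements = List.map left α
    member? : ∀ n → Dec (n ∈ elements)
    member? n = LAny.any? (n ≟_) elements
    A : Structure L
    A = record { dom = λ n → isYes (member? n) ; rel = λ _ _ → false ; rel-dom = λ _ _ () }
    holds : ∀ ℓ → ℓ ∈ α → D A ℓ
    holds ℓ ℓ∈α with isReflexive⇒ ℓ (subst (λ ℓ → IsReflexive ⌜ ℓ ⌝) (sym (lookup-index-≡ ℓ∈α)) (ref (LAny.index ℓ∈α)))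
      where
      lookup-index-≡ : ∀ {β} (p : ℓ ∈ β) → ℓ ≡ List.lookup β (LAny.index p)
      lookup-index-≡ (here refl) = refl
      lookup-index-≡ (there p)   = lookup-index-≡ p
    ... | a , refl = fromWitness (∈-map⁺ left ℓ∈α) , refl

  -- The equations n = n recover the universe, so the identity on ω restricts to the isomorphism.
  diagram-≅ : ∀ {A B : Structure L} → (∀ φ → D A φ ⇔ D B φ) → A ≅ B
  diagram-≅ {A} {B} same = mk↔ₛ′ forth back (λ _ → Universe-≡ B refl) (λ _ → Universe-≡ A refl) , λ i v →
    ⇔-trans (same (true , R[ i ] Vec.map proj₁ v)) (⇔-reflexive (λ w → T (rel B i w)) (Vecₚ.map-∘ proj₁ forth v))
    where
    forth : Universe A → Universe B
    forth (n , t) = n , proj₁ (to (same (true , eq n n)) (t , refl))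
    back : Universe B → Universe A
    back (n , t) = n , proj₁ (from (same (true , eq n n)) (t , refl))

-- The embedding of linear orders into vector spaces

Accepts : ℕ → ℕ → Set
-- The search for the length is bounded because no list is longer than its code.
Accepts l p = ∃ λ k → k < suc l × IsLength l k × CountsCode {LO-Lang} l k × SpaceTrue k p

Acceptsᶜ : Computable f → Computable g → Decidableᶜ (λ ρ → Accepts (f ρ) (g ρ))
Acceptsᶜ l p = ∃<ᶜ (sucᶜ l)
  ((∀<ᶜ k (¬ᶜ (suffixᶜ (weaken l′) (var 0F) ≡ᶜ lit 0)) ∧ᶜ (suffixᶜ l′ k ≡ᶜ lit 0)) ∧ᶜ
   (∀<ᶜ k (IsReflexiveᶜ (itemᶜ (weaken l′) (var 0F))) ∧ᶜ
    ∀<ᶜ k (∀<ᶜ (var 0F) (¬ᶜ (itemᶜ (weaken (weaken l′)) (var 1F) ≡ᶜ itemᶜ (weaken (weaken l′)) (var 0F))))) ∧ᶜ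
   SpaceTrueᶜ k (weaken p))
  where
  l′ = weaken l
  k  = var 0F

-- A finite linear order is determined by its size, so `α` is only asked to exhibit elements.
-- Requiring that it consist of nothing else makes the number k readable as its length.
Φ-FLO : List (Literal LO-Lang) → Literal VS-Lang → Set
Φ-FLO α φ = Counts α × D (space (List.length α)) φ

accepts-code : ∀ α φ → Φ-FLO α φ ⇔ Accepts ⌜ α ⌝ ⌜ φ ⌝
accepts-code α φ = mk⇔
  (λ (c , d) → List.length α , s≤s (length≤⌜⌝ α) , length-isLength α , to (counts-code α) c , to (D-space _ φ) d)
  (λ (k , _ , len , c , d) → accepted k (isLength-unique {⌜ α ⌝} len (length-isLength α)) c d)
  where
  accepted : ∀ k → k ≡ List.length α → CountsCode {LO-Lang} ⌜ α ⌝ k → SpaceTrue k ⌜ φ ⌝ → Φ-FLO α φ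
  accepted _ refl c d = from (counts-code α) c , from (D-space _ φ) d

Φ-FLO-CE : IsCE (λ (p : List (Literal LO-Lang) × Literal VS-Lang) → Φ-FLO (proj₁ p) (proj₂ p))
Φ-FLO-CE = decidable⇒CE (Acceptsᶜ (π₁ᶜ (var 0F)) (π₂ᶜ (var 0F))) λ (α , φ) → ⇔-trans (accepts-code α φ)
  (⇔-reflexive (λ (l , p) → Accepts l p) (sym (trans
    (cong (λ c → π₁ c , π₂ c) (code-, α φ))
    (cong₂ _,_ (π₁-⟪⟫ ⌜ α ⌝ ⌜ φ ⌝) (π₂-⟪⟫ ⌜ α ⌝ ⌜ φ ⌝)))))

-- An admissible `α` true in `A` lists at most n elements, so its space lies inside `space n`;
-- listing all n elements enumerates the whole diagram of `space n`.
Φ-FLO-maps : ∀ {A n} → toAStr A ≅ᴬ FinOrd n → A ⟶[ Φ-FLO ] space n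
Φ-FLO-maps {A} {n} (f , _) φ = mk⇔
  (λ (α , α⊆A , c , d) → space-⊆ (counts-≤ {A = A} f α⊆A c) φ d)
  (λ d → equations b , LAllₚ.tabulate⁺ (λ i → proj₂ (Inverse.from f i) , refl) ,
         equations-count b b-injective ,
         subst (λ k → D (space k) φ) (sym (length-tabulate (λ i → true , eq {LO-Lang} (b i) (b i)))) d)
  where
  b : Fin n → ℕ
  b i = proj₁ (Inverse.from f i)
  b-injective : ∀ {i j} → b i ≡ b j → i ≡ j
  b-injective e = ↔-to-injective (↔-sym f) (Universe-≡ A e)

FLO≤FVS : FLO ≤c FVS
FLO≤FVS = record
  { trans = record
    { Φ      = Φ-FLO
    ; ce     = Φ-FLO-CE
    ; finite = λ α φ (c , _) → counts-finite α c
    ; total  = λ A (n , p) → space n , (n , copy≅ (numbering n)) , Φ-FLO-maps p }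
  ; iso = λ A A′ B B′ (n , p) (n′ , p′) A⟶B A′⟶B′ → mk⇔
      (λ A≅A′ → via-space {A} {A′} {B} {B′} p A⟶B p′ A′⟶B′ (FinOrd-dimension (≅ᴬ-trans {X = FinOrd n} {toAStr A} {FinOrd n′} (≅ᴬ-sym {X = toAStr A} {FinOrd n} p)
        (≅ᴬ-trans {X = toAStr A} {toAStr A′} {FinOrd n′} A≅A′ p′))))
      (λ B≅B′ → via-FinOrd {A} {A′} p p′ (QVS-dimension (copy-≅⁻ (numbering n) (numbering n′)
        (≅ᴬ-trans {X = toAStr (space n)} {toAStr B} {toAStr (space n′)} (≅ᴬ-sym {X = toAStr B} {toAStr (space n)} (image-≅ p A⟶B))
          (≅ᴬ-trans {X = toAStr B} {toAStr B′} {toAStr (space n′)} B≅B′ (image-≅ p′ A′⟶B′)))))) }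
  where
  -- The image is given only through its diagram, so it is compared with the standard copy by
  -- comparing diagrams.
  image-≅ : ∀ {A B n} → toAStr A ≅ᴬ FinOrd n → A ⟶[ Φ-FLO ] B → B ≅ space n
  image-≅ {A} {B} {n} p A⟶B = diagram-≅ {A = B} {space n} (λ φ → ⇔-trans (⇔-sym (A⟶B φ)) (Φ-FLO-maps {A} p φ))
  FinOrd-dimension : ∀ {n n′} → FinOrd n ≅ᴬ FinOrd n′ → n ≡ n′
  FinOrd-dimension (f , _) = ↔⇒≡ f
  via-space : ∀ {A A′ B B′ n n′} → toAStr A ≅ᴬ FinOrd n → A ⟶[ Φ-FLO ] B →
              toAStr A′ ≅ᴬ FinOrd n′ → A′ ⟶[ Φ-FLO ] B′ → n ≡ n′ → B ≅ B′
  via-space {A} {A′} {B} {B′} {n} p A⟶B p′ A′⟶B′ refl = ≅ᴬ-trans {X = toAStr B} {toAStr (space n)} {toAStr B′} (image-≅ p A⟶B)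
    (≅ᴬ-sym {X = toAStr B′} {toAStr (space n)} (image-≅ p′ A′⟶B′))
  via-FinOrd : ∀ {A A′ n n′} → toAStr A ≅ᴬ FinOrd n → toAStr A′ ≅ᴬ FinOrd n′ → n ≡ n′ → A ≅ A′
  via-FinOrd {A} {A′} {n} p p′ refl = ≅ᴬ-trans {X = toAStr A} {FinOrd n} {toAStr A′} p (≅ᴬ-sym {X = toAStr A′} {FinOrd n} p′)

theorem2p6 : (FLO ≤c FVS) × ¬ (FVS ≤c FLO)
theorem2p6 = FLO≤FVS , FVS≰FLO
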